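{- Let $\mathcal{H}$ be a supersolvable hyperplane arrangement of rank $n\geq 2$. Then the graph of regions $G(\mathcal{H})$ has a Hamiltonian cycle of even length.
   Context: A hyperplane arrangement in $\mathbb{R}^d$ is a finite set $\mathcal{H}$ of linear hyperplanes (hyperplanes through the origin). Its rank is the dimension of the span of the normal vectors of its hyperplanes. The regions of $\mathcal{H}$ are the connected components of $\mathbb{R}^d\setminus\bigcup_{H\in\mathcal{H}}H$. The graph of regions $G(\mathcal{H})$ has the regions as vertices, two regions being adjacent if and only if they are separated by exactly one hyperplane of $\mathcal{H}$. Supersolvability is defined recursively on the rank: an arrangement $\mathcal{H}$ of rank $n$ is supersolvable if either $n\leq 2$, or $n\geq 3$ and $\mathcal{H}$ is the disjoint union of two nonempty arrangements $\mathcal{H}_0$ and $\mathcal{H}_1$, where $\mathcal{H}_0$ is a supersolvable arrangement of rank $n-1$, and for any two distinct hyperplanes $H',H''\in\mathcal{H}_1$ there exists $H\in\mathcal{H}_0$ with $H'\cap H''\subseteq H$. -}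

module Defs where

open import Algebra.Bundles using (CommutativeRing)
import Algebra.Definitions.RawMonoid as RawMonoidDefinitions
open import Data.Fin.Base using (Fin; toℕ)
open import Data.List.Base using (List; []; length; lookup)
import Data.List.Membership.Setoid as ListMembership
import Data.List.Relation.Binary.Disjoint.Setoid as ListDisjoint
import Data.List.Relation.Unary.Unique.Setoid as ListUnique
open import Data.Nat.Base as ℕ using (ℕ; suc)
open import Data.Product.Base using (_×_; _,_; ∃-syntax; proj₁)
open import Data.Product using (∃!)
open import Data.Sum.Base using (_⊎_; inj₁; inj₂)
open import Data.Vec.Functional using (Vector)
import Data.Vec.Functional.Relation.Binary.Equality.Setoid as VectorEquality
open import Function.Base using (_on_)
open import Function.Bundles using (_⇔_)
open import Function.Definitions using (Bijective)
open import Level using (Level; 0ℓ; _⊔_) renaming (suc to lsuc)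
open import Relation.Binary.Bundles using (Setoid)
open import Relation.Binary.Core using (Rel)
import Relation.Binary.Construct.On as On
import Relation.Binary.Construct.StrictToNonStrict as StrictToNonStrict
open import Relation.Binary.Definitions using (Symmetric; Irreflexive; _Respects₂_)
open import Relation.Binary.PropositionalEquality.Core using (_≡_; _≢_)
open import Relation.Binary.Structures using (IsStrictTotalOrder)
open import Relation.Nullary.Negation.Core using (¬_)
open import Relation.Unary using (Pred; _∈_; _∉_; _⊆_; _∪_; _∩_; _≐_; Satisfiable; Empty)
open import Relation.Unary.Relation.Binary.Equality using (≐-setoid)

------------------------------------------------------------------------
-- The real numbers

-- The field of real numbers is, up to isomorphism, the unique complete
-- ordered field. Decidable order (trichotomy) together with the full
-- least-upper-bound principle is the classical axiomatisation.

record CompleteOrderedField : Set₁ where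
  infix 4 _<_
  field
    commutativeRing : CommutativeRing 0ℓ 0ℓ
  open CommutativeRing commutativeRing public
  field
    _<_                : Rel Carrier 0ℓ
    isStrictTotalOrder : IsStrictTotalOrder _≈_ _<_
    0≉1                : 0# ≉ 1#
    invertible         : ∀ x → x ≉ 0# → ∃[ y ] x * y ≈ 1#
    +-monoˡ-<          : ∀ z {x y} → x < y → x + z < y + z
    *-pos              : ∀ {x y} → 0# < x → 0# < y → 0# < x * y

  open StrictToNonStrict _≈_ _<_ public using (_≤_)

  UpperBound : Pred Carrier 0ℓ → Pred Carrier 0ℓ
  UpperBound S b = ∀ {x} → x ∈ S → x ≤ b

  field
    supremum : (S : Pred Carrier 0ℓ) → Satisfiable S → Satisfiable (UpperBound S) →
               ∃[ s ] s ∈ UpperBound S × (∀ {b} → b ∈ UpperBound S → s ≤ b)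

  module Order = IsStrictTotalOrder isStrictTotalOrder

------------------------------------------------------------------------
-- Graphs

record Graph (v ℓ e : Level) : Set (lsuc (v ⊔ ℓ ⊔ e)) where
  infix 4 _~_
  field
    vertices : Setoid v ℓ
  open Setoid vertices public using () renaming (Carrier to Vertex; _≈_ to _≈ᵥ_)
  field
    _~_      : Rel Vertex e
    ~-sym    : Symmetric _~_
    ~-irrefl : Irreflexive _≈ᵥ_ _~_
    ~-resp   : _~_ Respects₂ _≈ᵥ_

-- The cyclic successor relation on Fin k.
data CyclicNext {k : ℕ} (i j : Fin k) : Set where
  step : toℕ j ≡ suc (toℕ i) → CyclicNext i j
  wrap : suc (toℕ i) ≡ k → toℕ j ≡ 0 → CyclicNext i j

record HamiltonianCycle {v ℓ e} (G : Graph v ℓ e) (k : ℕ) : Set (v ⊔ ℓ ⊔ e) where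
  open Graph G
  field
    length≥3  : 3 ℕ.≤ k
    vertex    : Fin k → Vertex
    bijective : Bijective _≡_ _≈ᵥ_ vertex
    adjacent  : ∀ {i j} → CyclicNext i j → vertex i ~ vertex j

module _ (ℝ : CompleteOrderedField) where
  open CompleteOrderedField ℝ
  open RawMonoidDefinitions +-rawMonoid using (sum)
  open VectorEquality setoid using (_≋_)

  ----------------------------------------------------------------------
  -- Linear algebra and topology of ℝᵈ

  Point : ℕ → Set
  Point d = Vector Carrier d

  dot : ∀ {d} → Point d → Point d → Carrier
  dot x y = sum (λ i → x i * y i)

  linearCombination : ∀ {m d} → (Fin m → Carrier) → (Fin m → Point d) → Point d
  linearCombination c v j = sum (λ i → c i * v i j)

  Span : ∀ {m d} → (Fin m → Point d) → Pred (Point d) 0ℓ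
  Span v x = ∃[ c ] x ≋ linearCombination c v

  LinearlyIndependent : ∀ {m d} → (Fin m → Point d) → Set
  LinearlyIndependent v = ∀ c → linearCombination c v ≋ (λ _ → 0#) → ∀ i → c i ≈ 0#

  record HasDimension {d} (W : Pred (Point d) 0ℓ) (n : ℕ) : Set where
    field
      basis       : Fin n → Point d
      basis⊆W     : ∀ i → basis i ∈ W
      independent : LinearlyIndependent basis
      spanning    : W ⊆ Span basis

  -- Open cubes form a base of the Euclidean topology.
  Open : ∀ {d} → Pred (Point d) 0ℓ → Set
  Open U = ∀ {x} → x ∈ U → ∃[ ε ] 0# < ε ×
    (∀ y → (∀ i → x i - ε < y i × y i < x i + ε) → y ∈ U)

  Connected : ∀ {d} → Pred (Point d) 0ℓ → Set₁
  Connected C = ∀ {U V} → Open U → Open V → C ⊆ U ∪ V →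
    Satisfiable (C ∩ U) → Satisfiable (C ∩ V) → ¬ Empty (C ∩ (U ∩ V))

  record IsConnectedComponent {d} (X P : Pred (Point d) 0ℓ) : Set₁ where
    field
      nonempty  : Satisfiable P
      contained : P ⊆ X
      connected : Connected P
      maximal   : ∀ {Q} → Q ⊆ X → Connected Q → P ⊆ Q → Q ⊆ P

  ----------------------------------------------------------------------
  -- Hyperplane arrangements

  record Hyperplane (d : ℕ) : Set where
    field
      normal   : Point d
      normal≉0 : ¬ (normal ≋ (λ _ → 0#))

  open Hyperplane

  ⟦_⟧ : ∀ {d} → Hyperplane d → Pred (Point d) 0ℓ
  ⟦ H ⟧ x = dot (normal H) x ≈ 0#

  positiveSide negativeSide : ∀ {d} → Hyperplane d → Pred (Point d) 0ℓ
  positiveSide H x = 0# < dot (normal H) x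
  negativeSide H x = dot (normal H) x < 0#

  -- Hyperplanes are compared as sets of points, so normal vectors that are
  -- nonzero multiples of each other give the same hyperplane.
  hyperplanes : ℕ → Setoid 0ℓ 0ℓ
  hyperplanes d = On.setoid (≐-setoid (Point d) 0ℓ) (⟦_⟧ {d})

  module _ {d : ℕ} where
    open Setoid (hyperplanes d) public using ()
      renaming (_≈_ to _≈ₕ_; _≉_ to _≉ₕ_)
    open ListMembership (hyperplanes d) public using () renaming (_∈_ to _∈ₕ_)
    open ListDisjoint (hyperplanes d) public using (Disjoint)
    open ListUnique (hyperplanes d) public using (Unique)

  record Arrangement (d : ℕ) : Set where
    field
      members : List (Hyperplane d)
      unique  : Unique members

  open Arrangement

  HasRank : ∀ {d} → Arrangement d → ℕ → Set
  HasRank A = HasDimension (Span (λ i → normal (lookup (members A) i)))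

  record IsDisjointUnion {d} (A A₀ A₁ : Arrangement d) : Set where
    field
      union    : ∀ {H} → H ∈ₕ members A ⇔ (H ∈ₕ members A₀ ⊎ H ∈ₕ members A₁)
      disjoint : Disjoint (members A₀) (members A₁)

  data Supersolvable {d} (A : Arrangement d) : Set where
    rank≤2 : ∀ {n} → HasRank A n → n ℕ.≤ 2 → Supersolvable A
    rank≥3 : ∀ {n} → HasRank A (suc n) → 3 ℕ.≤ suc n →
             (A₀ A₁ : Arrangement d) → IsDisjointUnion A A₀ A₁ →
             members A₀ ≢ [] → members A₁ ≢ [] →
             HasRank A₀ n → Supersolvable A₀ →
             (∀ {H′ H″} → H′ ∈ₕ members A₁ → H″ ∈ₕ members A₁ → H′ ≉ₕ H″ →
               ∃[ H ] H ∈ₕ members A₀ × ⟦ H′ ⟧ ∩ ⟦ H″ ⟧ ⊆ ⟦ H ⟧) →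
             Supersolvable A

  ----------------------------------------------------------------------
  -- The graph of regions

  Complement : ∀ {d} → Arrangement d → Pred (Point d) 0ℓ
  Complement A x = ∀ {H} → H ∈ₕ members A → x ∉ ⟦ H ⟧

  record Region {d} (A : Arrangement d) : Set₁ where
    field
      points      : Pred (Point d) 0ℓ
      isComponent : IsConnectedComponent (Complement A) points

  open Region

  Separates : ∀ {d} → Hyperplane d → Rel (Pred (Point d) 0ℓ) 0ℓ
  Separates H P Q = (P ⊆ positiveSide H × Q ⊆ negativeSide H)
                  ⊎ (P ⊆ negativeSide H × Q ⊆ positiveSide H)

  SeparatedByExactlyOne : ∀ {d} (A : Arrangement d) → Rel (Pred (Point d) 0ℓ) 0ℓ
  SeparatedByExactlyOne A P Q =
    ∃! _≈ₕ_ (λ H → H ∈ₕ members A × Separates H P Q)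

  private
    separates-sym : ∀ {d} (H : Hyperplane d) → Symmetric (Separates H)
    separates-sym _ (inj₁ (p , q)) = inj₂ (q , p)
    separates-sym _ (inj₂ (p , q)) = inj₁ (q , p)

    separates-antitone : ∀ {d} (H : Hyperplane d) {P P′ Q Q′} →
      P′ ⊆ P → Q′ ⊆ Q → Separates H P Q → Separates H P′ Q′
    separates-antitone _ f g (inj₁ (p , q)) = inj₁ ((λ x → p (f x)) , (λ x → q (g x)))
    separates-antitone _ f g (inj₂ (p , q)) = inj₂ ((λ x → p (f x)) , (λ x → q (g x)))

    exactlyOne-map : ∀ {d} (A : Arrangement d) {P P′ Q Q′} →
      (∀ H → Separates H P Q → Separates H P′ Q′) →
      (∀ H → Separates H P′ Q′ → Separates H P Q) →
      SeparatedByExactlyOne A P Q → SeparatedByExactlyOne A P′ Q′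
    exactlyOne-map _ f g (H , (H∈A , s) , only) =
      H , (H∈A , f H s) , λ {K} (K∈A , t) → only {K} (K∈A , g K t)

    not-separated : ∀ {d} (H : Hyperplane d) {P Q} → Satisfiable P → P ⊆ Q → ¬ Separates H P Q
    not-separated _ (_ , x∈P) f (inj₁ (p , q)) = Order.asym (p x∈P) (q (f x∈P))
    not-separated _ (_ , x∈P) f (inj₂ (p , q)) = Order.asym (p x∈P) (q (f x∈P))

  regionGraph : ∀ {d} → Arrangement d → Graph (lsuc 0ℓ) 0ℓ 0ℓ
  regionGraph {d} A = record
    { vertices = On.setoid (≐-setoid (Point d) 0ℓ) (points {A = A})
    ; _~_      = SeparatedByExactlyOne A on points
    ; ~-sym    = exactlyOne-map A (λ H → separates-sym H) (λ H → separates-sym H)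
    ; ~-irrefl = λ {R} R≐S (H , (_ , s) , _) →
        not-separated H (IsConnectedComponent.nonempty (isComponent R)) (proj₁ R≐S) s
    ; ~-resp   =
        (λ (f , g) → exactlyOne-map A
          (λ H → separates-antitone H (λ x → x) g)
          (λ H → separates-antitone H (λ x → x) f))
      , (λ (f , g) → exactlyOne-map A
          (λ H → separates-antitone H g (λ x → x))
          (λ H → separates-antitone H f (λ x → x)))
    }

{-# OPTIONS --safe #-}
module Submission where

-- Induction on the rank. Since A₀ has smaller rank than A, some vector v is orthogonal to all normals
-- of A₀ but not to all normals of A; by modularity v then lies on no hyperplane of A₁. A line
-- x + ℝ v with x in a region R of A₀ stays in R and meets every hyperplane of A₁ once. By modularity
-- again, the crossings are pairwise distinct and their order depends on R only, so the regions of A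
-- inside R form a path with |A₁| + 1 vertices, whose ends lie on the negative, respectively the
-- positive, side of all of A₁ (oriented by v). Hence the ends of the paths over adjacent regions of
-- A₀ are adjacent, and an even cycle for A₀ is lifted by traversing the paths alternately upwards
-- and downwards. In rank 2 the same step applies with A₀ a single hyperplane, whose two regions
-- form a degenerate cycle of length 2.

open import Defs
open import Algebra.Solver.Ring.AlmostCommutativeRing using (_-Raw-AlmostCommutative⟶_; fromCommutativeRing)
import Algebra.Properties.AbelianGroup
import Algebra.Properties.Ring
import Algebra.Properties.Semiring.Mult.TCOptimised
import Algebra.Properties.Semiring.Sum
import Algebra.Solver.Ring
open import Data.Bool.Base using (Bool; true; false; not)
open import Data.Empty using (⊥-elim)
open import Data.Fin.Base using (Fin; zero; suc; toℕ; punchIn; punchOut)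
import Data.Fin.Properties as Fin
open import Data.Integer.Base as ℤ using (ℤ; +_; -[1+_]; _⊖_; _◃_; sign; ∣_∣)
import Data.Integer.Properties as ℤ
open import Data.List.Base using (List; []; _∷_; _++_; length; lookup; map; foldr)
open import Data.List.Membership.Propositional.Properties using (∈-lookup)
import Data.List.Membership.Setoid.Properties as Membership
open import Data.List.Properties using (length-map; length-++; ++-identityʳ)
open import Data.List.Relation.Unary.All as All using (All; []; _∷_)
import Data.List.Relation.Unary.All.Properties as All
open import Data.List.Relation.Unary.AllPairs as AllPairs using (AllPairs; []; _∷_)
import Data.List.Relation.Unary.AllPairs.Properties as AllPairs
open import Data.List.Relation.Unary.Any as Any using (Any; here; there)
import Data.List.Relation.Unary.Any.Properties as Any
open import Data.Maybe.Base using (Maybe; just; nothing)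
open import Data.Nat.Base as ℕ using (ℕ; zero; suc; _≤_; s≤s; z≤n)
open import Data.Nat.Divisibility using (_∣_; divides; ∣-refl; ∣m⇒∣m*n; ∣⇒≤)
import Data.Nat.Properties as ℕ
open import Data.Product.Base using (_×_; _,_; ∃-syntax; proj₁; proj₂)
import Data.Sign.Base as Sign
open import Data.Sum.Base as Sum using (_⊎_; inj₁; inj₂; [_,_]′)
open import Data.Vec.Functional using (tail)
import Data.Vec.Functional.Relation.Binary.Equality.Setoid as VectorEquality
open import Function.Base using (_∘_)
open import Function.Bundles using (Equivalence; mk⇔)
open import Level using (Level; 0ℓ; _⊔_)
open import Relation.Binary.Core using (Rel)
open import Relation.Binary.Definitions using (Symmetric; tri<; tri≈; tri>)
open import Relation.Binary.PropositionalEquality as ≡ using (_≡_)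
open import Relation.Nullary using (¬_; Dec; yes; no; ¬?; contradiction; decidable-stable)
open import Relation.Unary using (Pred; _∈_; _⊆_; _≐_; _∩_; Satisfiable)

-- Regions are predicates on points, hence awkward to list or to compare. The combinatorial
-- arguments therefore run on representative points, two of them being identified when they lie on
-- the same side of each hyperplane (`Cell`); topology enters only where these classes are
-- identified with connected components.
--
-- Modularity controls the order of the crossings because, for distinct hyperplanes of `A₁`, the
-- difference of the two crossing parameters is a linear form in the base point whose zero set is a
-- hyperplane of `A₀`. Its sign is therefore constant on a region of `A₀`.
--
-- Evenness is part of the induction: after an odd number of alternating fibres the walk would stand
-- on the side of `A₁` opposite to its start and could not be closed up in this way. It is inherited
-- because each step multiplies the length by |A₁| + 1. The bound 3 on the length cannot be part of
-- the induction hypothesis, as the base cycle has length 2, but every extension has length at least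
-- 2 · 2.

-- Integer coefficients for the ring solver

module IntegerCoefficients (ℝ : CompleteOrderedField) where
  open CompleteOrderedField ℝ
  open Algebra.Properties.Ring ring using (-‿distribˡ-*; -‿distribʳ-*; -0#≈0#; -‿involutive)
  open Algebra.Properties.AbelianGroup +-abelianGroup using (⁻¹-∙-comm)
  open Algebra.Properties.Semiring.Mult.TCOptimised semiring using (1+×; ×-homo-+; ×1-homo-*)
    renaming (_×_ to _∙_)
  open import Relation.Binary.Reasoning.Setoid setoid

  -- The optimised multiple `1 ∙ 1#` computes to `1#`, so the solver constants 0 and 1 denote
  -- exactly `0#` and `1#`.
  fromℤ : ℤ → Carrier
  fromℤ (+ n)    = n ∙ 1#
  fromℤ -[1+ n ] = - (suc n ∙ 1#)

  fromℤ-⊖ : ∀ m n → fromℤ (m ⊖ n) ≈ m ∙ 1# - n ∙ 1#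
  fromℤ-⊖ zero    zero    = sym (trans (+-identityˡ _) -0#≈0#)
  fromℤ-⊖ zero    (suc n) = sym (+-identityˡ _)
  fromℤ-⊖ (suc m) zero    = sym (trans (+-congˡ -0#≈0#) (+-identityʳ _))
  fromℤ-⊖ (suc m) (suc n) = begin
    fromℤ (suc m ⊖ suc n)                         ≡⟨ ≡.cong fromℤ (ℤ.[1+m]⊖[1+n]≡m⊖n m n) ⟩
    fromℤ (m ⊖ n)                                 ≈⟨ fromℤ-⊖ m n ⟩
    m ∙ 1# - n ∙ 1#                               ≈⟨ +-congʳ (+-identityʳ _) ⟨
    m ∙ 1# + 0# - n ∙ 1#                          ≈⟨ +-congʳ (+-congˡ (-‿inverseʳ 1#)) ⟨
    m ∙ 1# + (1# - 1#) - n ∙ 1#                   ≈⟨ +-congʳ (+-assoc _ _ _) ⟨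
    m ∙ 1# + 1# - 1# - n ∙ 1#                     ≈⟨ +-assoc _ _ _ ⟩
    m ∙ 1# + 1# + (- 1# - n ∙ 1#)
      ≈⟨ +-cong (trans (+-comm _ _) (sym (1+× m 1#))) (trans (⁻¹-∙-comm _ _) (-‿cong (sym (1+× n 1#)))) ⟩
    suc m ∙ 1# - suc n ∙ 1#                       ∎

  fromℤ-+ : ∀ i j → fromℤ (i ℤ.+ j) ≈ fromℤ i + fromℤ j
  fromℤ-+ (+ m)    (+ n)    = ×-homo-+ 1# m n
  fromℤ-+ (+ m)    -[1+ n ] = fromℤ-⊖ m (suc n)
  fromℤ-+ -[1+ m ] (+ n)    = trans (fromℤ-⊖ n (suc m)) (+-comm _ _)
  fromℤ-+ -[1+ m ] -[1+ n ] = begin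
    - (suc (suc (m ℕ.+ n)) ∙ 1#)       ≡⟨ ≡.cong (λ k → - (k ∙ 1#)) (≡.sym (ℕ-+-suc m n)) ⟩
    - ((suc m ℕ.+ suc n) ∙ 1#)         ≈⟨ -‿cong (×-homo-+ 1# (suc m) (suc n)) ⟩
    - (suc m ∙ 1# + suc n ∙ 1#)        ≈⟨ ⁻¹-∙-comm _ _ ⟨
    - (suc m ∙ 1#) - suc n ∙ 1#        ∎
    where
    open import Data.Nat.Properties using (+-suc)
    ℕ-+-suc : ∀ m n → suc m ℕ.+ suc n ≡ suc (suc (m ℕ.+ n))
    ℕ-+-suc m n = ≡.cong suc (+-suc m n)

  signed : Sign.Sign → Carrier → Carrier
  signed Sign.+ x = x
  signed Sign.- x = - x

  fromℤ-◃ : ∀ s n → fromℤ (s ◃ n) ≈ signed s (n ∙ 1#)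
  fromℤ-◃ Sign.+ zero    = refl
  fromℤ-◃ Sign.- zero    = sym -0#≈0#
  fromℤ-◃ Sign.+ (suc n) = refl
  fromℤ-◃ Sign.- (suc n) = refl

  fromℤ-signed : ∀ i → fromℤ i ≈ signed (sign i) (∣ i ∣ ∙ 1#)
  fromℤ-signed (+ n)    = refl
  fromℤ-signed -[1+ n ] = refl

  signed-* : ∀ s t {x y z} → z ≈ x * y → signed (s Sign.* t) z ≈ signed s x * signed t y
  signed-* Sign.+ Sign.+ e = e
  signed-* Sign.+ Sign.- e = trans (-‿cong e) (-‿distribʳ-* _ _)
  signed-* Sign.- Sign.+ e = trans (-‿cong e) (-‿distribˡ-* _ _)
  signed-* Sign.- Sign.- {x} {y} e = begin
    _             ≈⟨ e ⟩
    x * y         ≈⟨ -‿involutive _ ⟨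
    - (- (x * y)) ≈⟨ -‿cong (-‿distribˡ-* _ _) ⟩
    - ((- x) * y) ≈⟨ -‿distribʳ-* _ _ ⟩
    (- x) * (- y) ∎

  fromℤ-* : ∀ i j → fromℤ (i ℤ.* j) ≈ fromℤ i * fromℤ j
  fromℤ-* i j = begin
    fromℤ (i ℤ.* j)                                         ≈⟨ fromℤ-◃ (sign i Sign.* sign j) (∣ i ∣ ℕ.* ∣ j ∣) ⟩
    signed (sign i Sign.* sign j) ((∣ i ∣ ℕ.* ∣ j ∣) ∙ 1#)  ≈⟨ signed-* (sign i) (sign j) (×1-homo-* ∣ i ∣ ∣ j ∣) ⟩
    signed (sign i) (∣ i ∣ ∙ 1#) * signed (sign j) (∣ j ∣ ∙ 1#) ≈⟨ *-cong (fromℤ-signed i) (fromℤ-signed j) ⟨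
    fromℤ i * fromℤ j                                       ∎

  fromℤ-neg : ∀ i → fromℤ (ℤ.- i) ≈ - fromℤ i
  fromℤ-neg (+ zero)  = sym -0#≈0#
  fromℤ-neg (+ suc n) = refl
  fromℤ-neg -[1+ n ]  = sym (-‿involutive _)

  -- Equality of the abstract carrier does not compute, so the solver could not cancel terms with
  -- coefficients taken from the field itself.
  homomorphism : ℤ.+-*-rawRing -Raw-AlmostCommutative⟶ fromCommutativeRing commutativeRing
  homomorphism = record
    { ⟦_⟧    = fromℤ
    ; +-homo = fromℤ-+
    ; *-homo = fromℤ-*
    ; -‿homo = fromℤ-neg
    ; 0-homo = refl
    ; 1-homo = refl
    }

  fromℤ-≟ : ∀ i j → Maybe (fromℤ i ≈ fromℤ j)
  fromℤ-≟ i j with i ℤ.≟ j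
  ... | yes ≡.refl = just refl
  ... | no _       = nothing

  module RingSolver = Algebra.Solver.Ring ℤ.+-*-rawRing (fromCommutativeRing commutativeRing) homomorphism fromℤ-≟

-- Ordered field arithmetic

module OrderedField (ℝ : CompleteOrderedField) where
  open CompleteOrderedField ℝ
  open IntegerCoefficients ℝ using (module RingSolver)
  open RingSolver using (solve; _:=_; _:+_; _:*_; _:-_; :-_; con)

  :0 :1 : ∀ {n} → RingSolver.Polynomial n
  :0 = con (+ 0)
  :1 = con (+ 1)

  abstract
    <-respʳ : ∀ {x y z} → y ≈ z → x < y → x < z
    <-respʳ = Order.<-respʳ-≈

    <-respˡ : ∀ {x y z} → y ≈ z → y < x → z < x
    <-respˡ = Order.<-respˡ-≈

    <-irrefl : ∀ {x} → ¬ x < x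
    <-irrefl = Order.irrefl refl

    pos⇒≉0 : ∀ {x} → 0# < x → x ≉ 0#
    pos⇒≉0 p e = Order.irrefl (sym e) p

    difference-pos⇒< : ∀ {x y z} → z ≈ y - x → 0# < z → x < y
    difference-pos⇒< {x} {y} e 0<z =
      <-respˡ (+-identityˡ x) (<-respʳ (trans (+-congʳ e) (solve 2 (λ x y → y :- x :+ x := y) refl x y)) (+-monoˡ-< x 0<z))

    <⇒difference-pos : ∀ {x y z} → z ≈ y - x → x < y → 0# < z
    <⇒difference-pos {x} {y} e x<y =
      <-respˡ (-‿inverseʳ x) (<-respʳ (sym e) (+-monoˡ-< (- x) x<y))

    +-pos : ∀ {x y} → 0# < x → 0# < y → 0# < x + y
    +-pos {x} {y} 0<x 0<y = Order.trans 0<y (<-respˡ (+-identityˡ y) (+-monoˡ-< y 0<x))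

    neg⇒-pos : ∀ {x} → x < 0# → 0# < - x
    neg⇒-pos {x} = <⇒difference-pos (solve 1 (λ x → :- x := :0 :- x) refl x)

    pos⇒-neg : ∀ {x} → 0# < x → - x < 0#
    pos⇒-neg {x} = difference-pos⇒< (solve 1 (λ x → x := :0 :- (:- x)) refl x)

    0<1 : 0# < 1#
    0<1 with Order.compare 0# 1#
    ... | tri< p _ _ = p
    ... | tri≈ _ e _ = contradiction e 0≉1
    ... | tri> _ _ p = <-respʳ (solve 0 ((:- :1) :* (:- :1) := :1) refl) (*-pos (neg⇒-pos p) (neg⇒-pos p))

    +-monoʳ-< : ∀ z {x y} → x < y → z + x < z + y
    +-monoʳ-< z p = <-respˡ (+-comm _ _) (<-respʳ (+-comm _ _) (+-monoˡ-< z p))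

    +-mono-< : ∀ {w x y z} → w < x → y < z → w + y < x + z
    +-mono-< {x = x} {y} p q = Order.trans (+-monoˡ-< y p) (+-monoʳ-< x q)

    neg-antimono-< : ∀ {x y} → x < y → - y < - x
    neg-antimono-< {x} {y} x<y =
      difference-pos⇒< (solve 2 (λ x y → y :- x := (:- x) :- (:- y)) refl x y) (<⇒difference-pos refl x<y)

    *-monoˡ-< : ∀ {z x y} → 0# < z → x < y → z * x < z * y
    *-monoˡ-< {z} {x} {y} 0<z x<y =
      difference-pos⇒< (solve 3 (λ z x y → z :* (y :- x) := z :* y :- z :* x) refl z x y)
        (*-pos 0<z (<⇒difference-pos refl x<y))

    -- Made total by a default value at zero, so that quotients such as `crossing` and `slide` are
    -- plain terms that do not depend on a proof of nonvanishing.
    inv : Carrier → Carrier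
    inv x with x Order.≟ 0#
    ... | yes _   = 0#
    ... | no x≉0 = proj₁ (invertible x x≉0)

    *-inv : ∀ {x} → x ≉ 0# → x * inv x ≈ 1#
    *-inv {x} x≉0 with x Order.≟ 0#
    ... | yes x≈0 = contradiction x≈0 x≉0
    ... | no x≉0′ = proj₂ (invertible x x≉0′)

    *-cancelˡ-0 : ∀ {x y} → x ≉ 0# → x * y ≈ 0# → y ≈ 0#
    *-cancelˡ-0 {x} {y} x≉0 e = begin
      y                ≈⟨ *-identityˡ y ⟨
      1# * y           ≈⟨ *-congʳ (*-inv x≉0) ⟨
      x * inv x * y    ≈⟨ solve 3 (λ x i y → x :* i :* y := i :* (x :* y)) refl x (inv x) y ⟩
      inv x * (x * y)  ≈⟨ *-congˡ e ⟩
      inv x * 0#       ≈⟨ zeroʳ _ ⟩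
      0#               ∎
      where open import Relation.Binary.Reasoning.Setoid setoid

    *-≉0 : ∀ {x y} → x ≉ 0# → y ≉ 0# → x * y ≉ 0#
    *-≉0 x≉0 y≉0 e = y≉0 (*-cancelˡ-0 x≉0 e)

    square-pos : ∀ {x} → x ≉ 0# → 0# < x * x
    square-pos {x} x≉0 with Order.compare 0# x
    ... | tri< p _ _ = *-pos p p
    ... | tri≈ _ e _ = contradiction (sym e) x≉0
    ... | tri> _ _ p = <-respʳ (solve 1 (λ x → (:- x) :* (:- x) := x :* x) refl x) (*-pos (neg⇒-pos p) (neg⇒-pos p))

    *-pos-cancelˡ : ∀ {x y} → 0# < x → 0# < x * y → 0# < y
    *-pos-cancelˡ {x} {y} 0<x 0<xy with Order.compare 0# y
    ... | tri< p _ _ = p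
    ... | tri≈ _ e _ = contradiction (<-respʳ (trans (*-congˡ (sym e)) (zeroʳ x)) 0<xy) <-irrefl
    ... | tri> _ _ p = contradiction (Order.trans 0<xy (<-respʳ (zeroʳ x) (*-monoˡ-< 0<x p))) <-irrefl

    inv-pos : ∀ {x} → 0# < x → 0# < inv x
    inv-pos 0<x = *-pos-cancelˡ 0<x (<-respʳ (sym (*-inv (pos⇒≉0 0<x))) 0<1)

  -- Equal and opposite signs

  infix 4 _∼_ _≁_

  -- Both relations exclude zero. Expressed by products they are unchanged when both arguments are
  -- multiplied by the same nonzero factor, so hyperplanes, whose normals are determined up to
  -- scaling, need no chosen orientation.
  _∼_ _≁_ : Carrier → Carrier → Set
  x ∼ y = 0# < x * y
  x ≁ y = x * y < 0#

  abstract
    ∼-refl : ∀ {x} → x ≉ 0# → x ∼ x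
    ∼-refl = square-pos

    ∼-sym : ∀ {x y} → x ∼ y → y ∼ x
    ∼-sym = <-respʳ (*-comm _ _)

    ≁-sym : ∀ {x y} → x ≁ y → y ≁ x
    ≁-sym = <-respˡ (*-comm _ _)

    ∼-respˡ : ∀ {x y z} → x ≈ y → x ∼ z → y ∼ z
    ∼-respˡ e = <-respʳ (*-congʳ e)

    ∼-respʳ : ∀ {x y z} → x ≈ y → z ∼ x → z ∼ y
    ∼-respʳ e = <-respʳ (*-congˡ e)

    ∼⇒≉0ˡ : ∀ {x y} → x ∼ y → x ≉ 0#
    ∼⇒≉0ˡ p e = <-irrefl (<-respʳ (trans (*-congʳ e) (zeroˡ _)) p)

    ∼⇒≉0ʳ : ∀ {x y} → x ∼ y → y ≉ 0#
    ∼⇒≉0ʳ p = ∼⇒≉0ˡ (∼-sym p)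

    -- The product of `x * y` and `y * z` is `x * z` times the square of `y`, and `y` is nonzero
    -- because `x * y` is.
    ∼-trans : ∀ {x y z} → x ∼ y → y ∼ z → x ∼ z
    ∼-trans {x} {y} {z} p q = *-pos-cancelˡ (square-pos (∼⇒≉0ʳ p))
      (<-respʳ (solve 3 (λ x y z → (x :* y) :* (y :* z) := (y :* y) :* (x :* z)) refl x y z) (*-pos p q))

    ≁⇒∼- : ∀ {x y} → x ≁ y → x ∼ - y
    ≁⇒∼- {x} {y} p = <-respʳ (solve 2 (λ x y → :- (x :* y) := x :* (:- y)) refl x y) (neg⇒-pos p)

    ∼-⇒≁ : ∀ {x y} → x ∼ - y → x ≁ y
    ∼-⇒≁ {x} {y} p = <-respˡ (solve 2 (λ x y → :- (x :* (:- y)) := x :* y) refl x y) (pos⇒-neg p)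

    ≁⇒-∼ : ∀ {x y} → x ≁ y → - x ∼ y
    ≁⇒-∼ p = ∼-sym (≁⇒∼- (≁-sym p))

    ∼-≁-trans : ∀ {x y z} → x ∼ y → y ≁ z → x ≁ z
    ∼-≁-trans p q = ∼-⇒≁ (∼-trans p (≁⇒∼- q))

    ≁-∼-trans : ∀ {x y z} → x ≁ y → y ∼ z → x ≁ z
    ≁-∼-trans p q = ≁-sym (∼-≁-trans (∼-sym q) (≁-sym p))

    ≁-trans : ∀ {x y z} → x ≁ y → y ≁ z → x ∼ z
    ≁-trans {x} {y} {z} p q = ∼-trans (≁⇒∼- p) (≁⇒-∼ q)

    ∼⇒¬≁ : ∀ {x y} → x ∼ y → ¬ x ≁ y
    ∼⇒¬≁ = Order.asym

    ∼⊎≁ : ∀ {x y} → x ≉ 0# → y ≉ 0# → x ∼ y ⊎ x ≁ y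
    ∼⊎≁ {x} {y} x≉0 y≉0 with Order.compare 0# (x * y)
    ... | tri< p _ _ = inj₁ p
    ... | tri≈ _ e _ = contradiction (sym e) (*-≉0 x≉0 y≉0)
    ... | tri> _ _ p = inj₂ p

    ∼-pos : ∀ {x y} → 0# < x → x ∼ y → 0# < y
    ∼-pos = *-pos-cancelˡ

    ∼-neg : ∀ {x y} → x < 0# → x ∼ y → y < 0#
    ∼-neg {x} {y} x<0 p = <-respˡ (solve 1 (λ y → :- (:- y) := y) refl y)
      (pos⇒-neg (∼-pos (neg⇒-pos x<0) (<-respʳ (solve 2 (λ x y → x :* y := (:- x) :* (:- y)) refl x y) p)))

    ∼-*-scale : ∀ {c x y} → c ≉ 0# → x ∼ y → c * x ∼ c * y
    ∼-*-scale {c} {x} {y} c≉0 p = <-respʳ (solve 3 (λ c x y → (c :* c) :* (x :* y) := (c :* x) :* (c :* y)) refl c x y)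
      (*-pos (square-pos c≉0) p)

    pos-≁-neg : ∀ {x y} → 0# < x → y < 0# → x ≁ y
    pos-≁-neg p q = ∼-⇒≁ (*-pos p (neg⇒-pos q))

    ≁⇒cases : ∀ {x y} → x ≁ y → (0# < x × y < 0#) ⊎ (x < 0# × 0# < y)
    ≁⇒cases {x} {y} p with Order.compare 0# x
    ... | tri< q _ _ = inj₁ (q , <-respˡ (solve 1 (λ y → :- (:- y) := y) refl y) (pos⇒-neg (∼-pos q (≁⇒∼- p))))
    ... | tri≈ _ e _ = contradiction (<-respˡ (trans (*-congʳ (sym e)) (zeroˡ y)) p) <-irrefl
    ... | tri> _ _ q = inj₂ (q , ∼-pos (neg⇒-pos q) (≁⇒-∼ p))

    ½ : Carrier
    ½ = inv (1# + 1#)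

    0<½ : 0# < ½
    0<½ = inv-pos (+-pos 0<1 0<1)

    ½+½≈1 : ½ + ½ ≈ 1#
    ½+½≈1 = trans (solve 1 (λ h → h :+ h := (:1 :+ :1) :* h) refl ½) (*-inv (pos⇒≉0 (+-pos 0<1 0<1)))

    midpoint : Carrier → Carrier → Carrier
    midpoint x y = x + ½ * (y - x)

    <-midpoint : ∀ {x y} → x < y → x < midpoint x y
    <-midpoint {x} {y} x<y = difference-pos⇒< (solve 2 (λ x z → z := x :+ z :- x) refl x (½ * (y - x)))
      (*-pos 0<½ (<⇒difference-pos refl x<y))

    midpoint-< : ∀ {x y} → x < y → midpoint x y < y
    midpoint-< {x} {y} x<y = difference-pos⇒< e (*-pos 0<½ (<⇒difference-pos refl x<y))
      where
      open import Relation.Binary.Reasoning.Setoid setoid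
      e : ½ * (y - x) ≈ y - midpoint x y
      e = begin
        ½ * (y - x)
          ≈⟨ solve 3 (λ h x y → h :* (y :- x) := (h :+ h) :* (y :- x) :- h :* (y :- x)) refl ½ x y ⟩
        (½ + ½) * (y - x) - ½ * (y - x)               ≈⟨ +-congʳ (*-congʳ ½+½≈1) ⟩
        1# * (y - x) - ½ * (y - x)
          ≈⟨ solve 3 (λ h x y → :1 :* (y :- x) :- h :* (y :- x) := y :- (x :+ h :* (y :- x))) refl ½ x y ⟩
        y - midpoint x y                              ∎

-- Linear algebra: scalar products, spans, dependence

module LinearAlgebra (ℝ : CompleteOrderedField) where
  open CompleteOrderedField ℝ hiding (zero; _≤_)
  open OrderedField ℝ
  open IntegerCoefficients.RingSolver ℝ using (solve; _:=_; _:+_; _:*_; _:-_; :-_)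
  open Algebra.Properties.Semiring.Sum semiring using (sum; sum-cong-≋; ∑-distrib-+; ∑-comm; *-distribˡ-sum; *-distribʳ-sum)
  open VectorEquality setoid using (_≋_; ≋-sym)

  private
    Pt : ℕ → Set
    Pt = Point ℝ

    infix 9 _·_
    _·_ : ∀ {d} → Pt d → Pt d → Carrier
    _·_ = dot ℝ

  𝟎 : ∀ {d} → Pt d
  𝟎 _ = 0#

  infixl 6 _⊕_
  infixr 7 _⊙_

  _⊕_ : ∀ {d} → Pt d → Pt d → Pt d
  (x ⊕ y) i = x i + y i

  _⊙_ : ∀ {d} → Carrier → Pt d → Pt d
  (c ⊙ x) i = c * x i

  dot-cong : ∀ {d} {x x′ y y′ : Pt d} → x ≋ x′ → y ≋ y′ → x · y ≈ x′ · y′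
  dot-cong p q = sum-cong-≋ λ i → *-cong (p i) (q i)

  dot-congʳ : ∀ {d} (x : Pt d) {y y′} → y ≋ y′ → x · y ≈ x · y′
  dot-congʳ x q = dot-cong {x = x} (λ _ → refl) q

  dot-comm : ∀ {d} (x y : Pt d) → x · y ≈ y · x
  dot-comm x y = sum-cong-≋ λ i → *-comm (x i) (y i)

  dot-⊕ʳ : ∀ {d} (x y z : Pt d) → x · (y ⊕ z) ≈ x · y + x · z
  dot-⊕ʳ x y z = trans (sum-cong-≋ λ i → distribˡ (x i) (y i) (z i)) (∑-distrib-+ (λ i → x i * y i) (λ i → x i * z i))

  dot-⊙ʳ : ∀ {d} c (x y : Pt d) → x · (c ⊙ y) ≈ c * x · y
  dot-⊙ʳ c x y = trans
    (sum-cong-≋ λ i → solve 3 (λ c x y → x :* (c :* y) := c :* (x :* y)) refl c (x i) (y i))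
    (sym (*-distribˡ-sum c (λ i → x i * y i)))

  dot-⊕ˡ : ∀ {d} (x y z : Pt d) → (x ⊕ y) · z ≈ x · z + y · z
  dot-⊕ˡ x y z = trans (dot-comm (x ⊕ y) z) (trans (dot-⊕ʳ z x y) (+-cong (dot-comm z x) (dot-comm z y)))

  dot-⊙ˡ : ∀ {d} c (x y : Pt d) → (c ⊙ x) · y ≈ c * x · y
  dot-⊙ˡ c x y = trans (dot-comm (c ⊙ x) y) (trans (dot-⊙ʳ c y x) (*-congˡ (dot-comm y x)))

  dot-along : ∀ {d} (h x : Pt d) s v → h · (x ⊕ s ⊙ v) ≈ h · x + s * h · v
  dot-along h x s v = trans (dot-⊕ʳ h x (s ⊙ v)) (+-congˡ (dot-⊙ʳ s h v))

  dot-combine : ∀ {d} a (x : Pt d) b y z → (a ⊙ x ⊕ b ⊙ y) · z ≈ a * x · z + b * y · z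
  dot-combine a x b y z = trans (dot-⊕ˡ (a ⊙ x) (b ⊙ y) z) (+-cong (dot-⊙ˡ a x z) (dot-⊙ˡ b y z))

  dot-𝟎ˡ : ∀ {d} {x : Pt d} y → x ≋ 𝟎 → x · y ≈ 0#
  dot-𝟎ˡ {x = x} y e = begin
    x · y              ≈⟨ dot-cong {x = x} {y = y} e′ (λ _ → refl) ⟩
    (0# ⊙ x) · y       ≈⟨ dot-⊙ˡ 0# x y ⟩
    0# * x · y         ≈⟨ zeroˡ _ ⟩
    0#                 ∎
    where
    open import Relation.Binary.Reasoning.Setoid setoid
    e′ : x ≋ 0# ⊙ x
    e′ i = trans (e i) (sym (zeroˡ _))

  -- One nonzero coordinate makes the sum of squares positive. In the form of a disjunction this
  -- also decides whether a vector vanishes.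
  ≋𝟎⊎dot-self-pos : ∀ {d} (x : Pt d) → x ≋ 𝟎 ⊎ 0# < x · x
  ≋𝟎⊎dot-self-pos {zero}  x = inj₁ λ ()
  ≋𝟎⊎dot-self-pos {suc d} x with x zero Order.≟ 0# | ≋𝟎⊎dot-self-pos (tail x)
  ... | yes x₀≈0 | inj₁ e = inj₁ λ { zero → x₀≈0 ; (suc i) → e i }
  ... | yes x₀≈0 | inj₂ p = inj₂ (<-respʳ (sym (trans (+-congʳ (trans (*-congʳ x₀≈0) (zeroˡ _))) (+-identityˡ _))) p)
  ... | no x₀≉0  | inj₁ e = inj₂ (<-respʳ (sym (trans (+-congˡ (dot-𝟎ˡ (tail x) e)) (+-identityʳ _))) (square-pos x₀≉0))
  ... | no x₀≉0  | inj₂ p = inj₂ (+-pos (square-pos x₀≉0) p)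

  ≋𝟎⊎≉0 : ∀ {d} (x : Pt d) → x ≋ 𝟎 ⊎ x · x ≉ 0#
  ≋𝟎⊎≉0 x with ≋𝟎⊎dot-self-pos x
  ... | inj₁ e = inj₁ e
  ... | inj₂ p = inj₂ (pos⇒≉0 p)

  ≉𝟎⇒dot-self-pos : ∀ {d} {x : Pt d} → ¬ x ≋ 𝟎 → 0# < x · x
  ≉𝟎⇒dot-self-pos {x = x} x≉𝟎 with ≋𝟎⊎dot-self-pos x
  ... | inj₁ e = contradiction e x≉𝟎
  ... | inj₂ p = p

  dot-vanishes⇒≋𝟎 : ∀ {d} {x : Pt d} → (∀ y → x · y ≈ 0#) → x ≋ 𝟎
  dot-vanishes⇒≋𝟎 {x = x} f with ≋𝟎⊎≉0 x
  ... | inj₁ e = e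
  ... | inj₂ ne = contradiction (f x) ne

  -- The point of the line x + ℝ v on the hyperplane with normal h (x itself if h · v ≈ 0, as inv 0# is 0#).
  slide : ∀ {d} → Pt d → Pt d → Pt d → Pt d
  slide h v x = x ⊕ (- (h · x * inv (h · v))) ⊙ v

  dot-slide : ∀ {d} (k h v x : Pt d) → k · slide h v x ≈ k · x - h · x * inv (h · v) * k · v
  dot-slide k h v x = trans (dot-along k x _ v)
    (solve 3 (λ a b c → a :+ (:- b) :* c := a :- b :* c) refl (k · x) (h · x * inv (h · v)) (k · v))

  dot-slide-self : ∀ {d} (h : Pt d) {v} x → h · v ≉ 0# → h · slide h v x ≈ 0#
  dot-slide-self h {v} x hv≉0 = begin
    h · slide h v x                           ≈⟨ dot-slide h h v x ⟩
    h · x - h · x * inv (h · v) * h · v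
      ≈⟨ solve 3 (λ a i b → a :- a :* i :* b := a :- a :* (b :* i)) refl (h · x) (inv (h · v)) (h · v) ⟩
    h · x - h · x * (h · v * inv (h · v))     ≈⟨ +-congˡ (-‿cong (*-congˡ (*-inv hv≉0))) ⟩
    h · x - h · x * 1#                        ≈⟨ solve 1 (λ a → a :- a :* :1 := :0) refl (h · x) ⟩
    0#                                        ∎
    where open import Relation.Binary.Reasoning.Setoid setoid

  -- Sliding `x` along `v` into the kernel of `h` brings it into the kernel of `k` as well, and
  -- changes `k · x` by a fixed multiple of `h · x`.
  kernel⊆⇒proportional : ∀ {d} {h k : Pt d} {v} → h · v ≉ 0# → (∀ x → h · x ≈ 0# → k · x ≈ 0#) →
    ∃[ c ] ∀ x → k · x ≈ c * h · x
  kernel⊆⇒proportional {h = h} {k} {v} hv≉0 ker = inv (h · v) * k · v , λ x → begin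
    k · x
      ≈⟨ solve 2 (λ a b → a := (a :- b) :+ b) refl (k · x) (h · x * inv (h · v) * k · v) ⟩
    (k · x - h · x * inv (h · v) * k · v) + h · x * inv (h · v) * k · v  ≈⟨ +-congʳ (dot-slide k h v x) ⟨
    k · slide h v x + h · x * inv (h · v) * k · v             ≈⟨ +-congʳ (ker _ (dot-slide-self h x hv≉0)) ⟩
    0# + h · x * inv (h · v) * k · v
      ≈⟨ solve 3 (λ a i b → :0 :+ a :* i :* b := i :* b :* a) refl (h · x) (inv (h · v)) (k · v) ⟩
    inv (h · v) * k · v * h · x                               ∎
    where open import Relation.Binary.Reasoning.Setoid setoid

  -- Covers both uses of `Span-least`: spans contained in spans, and vectors annihilated by a point.
  -- `resp` is a field because vectors are functions compared pointwise.
  record Subspace {d} (W : Pred (Pt d) 0ℓ) : Set₁ where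
    field
      resp : ∀ {x y} → x ≋ y → W x → W y
      zeroᵂ : W 𝟎
      addᵂ : ∀ {x y} → W x → W y → W (x ⊕ y)
      scaleᵂ : ∀ c {x} → W x → W (c ⊙ x)

  Span-least : ∀ {m d} {v : Fin m → Pt d} {W} → Subspace W → (∀ i → W (v i)) → Span ℝ v ⊆ W
  Span-least {m} {d} {v} {W} S v∈W {x} (c , e) = resp (≋-sym {d} {x} {linearCombination ℝ c v} e) (combination m v∈W)
    where
    open Subspace S
    combination : ∀ m {c : Fin m → Carrier} {v : Fin m → Pt d} → (∀ i → W (v i)) → W (linearCombination ℝ c v)
    combination zero    f = zeroᵂ
    combination (suc m) {c} f = addᵂ (scaleᵂ (c zero) (f zero)) (combination m (f ∘ suc))

  linearCombination-⊕ : ∀ {m d} a b (v : Fin m → Pt d) →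
    linearCombination ℝ a v ⊕ linearCombination ℝ b v ≋ linearCombination ℝ (λ i → a i + b i) v
  linearCombination-⊕ a b v j = trans (sym (∑-distrib-+ (λ i → a i * v i j) (λ i → b i * v i j)))
    (sum-cong-≋ λ i → sym (distribʳ (v i j) (a i) (b i)))

  linearCombination-⊙ : ∀ {m d} c a (v : Fin m → Pt d) →
    c ⊙ linearCombination ℝ a v ≋ linearCombination ℝ (λ i → c * a i) v
  linearCombination-⊙ c a v j = trans (*-distribˡ-sum c (λ i → a i * v i j))
    (sum-cong-≋ λ i → sym (*-assoc c (a i) (v i j)))

  linearCombination-cong : ∀ {m d} {a b : Fin m → Carrier} (v : Fin m → Pt d) → (∀ i → a i ≈ b i) →
    linearCombination ℝ a v ≋ linearCombination ℝ b v
  linearCombination-cong v e j = sum-cong-≋ λ i → *-congʳ (e i)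

  linearCombination-0 : ∀ {m d} (v : Fin m → Pt d) → linearCombination ℝ (λ _ → 0#) v ≋ 𝟎
  linearCombination-0 v j = dot-𝟎ˡ (λ i → v i j) (λ _ → refl)

  Span-subspace : ∀ {m d} (v : Fin m → Pt d) → Subspace (Span ℝ v)
  Span-subspace v = record
    { resp   = λ e (c , f) → c , λ j → trans (sym (e j)) (f j)
    ; zeroᵂ  = (λ _ → 0#) , λ j → sym (linearCombination-0 v j)
    ; addᵂ   = λ (a , e) (b , f) → (λ i → a i + b i) , λ j → trans (+-cong (e j) (f j)) (linearCombination-⊕ a b v j)
    ; scaleᵂ = λ c (a , e) → (λ i → c * a i) , λ j → trans (*-congˡ (e j)) (linearCombination-⊙ c a v j)
    }

  annihilator-subspace : ∀ {d} (x : Pt d) → Subspace (λ h → h · x ≈ 0#)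
  annihilator-subspace x = record
    { resp   = λ {h} {k} e p → trans (sym (dot-cong {x = h} {y = x} e (λ _ → refl))) p
    ; zeroᵂ  = dot-𝟎ˡ x (λ _ → refl)
    ; addᵂ   = λ {h} {k} p q → trans (dot-⊕ˡ h k x) (trans (+-cong p q) (+-identityˡ 0#))
    ; scaleᵂ = λ c {h} p → trans (dot-⊙ˡ c h x) (trans (*-congˡ p) (zeroʳ c))
    }

  Span-suc : ∀ {m d} {v : Fin (suc m) → Pt d} → Span ℝ (tail v) ⊆ Span ℝ v
  Span-suc {v = v} (c , e) = (λ { zero → 0# ; (suc i) → c i }) ,
    λ j → trans (e j) (sym (trans (+-congʳ (zeroˡ _)) (+-identityˡ _)))

  Span-basis : ∀ {m d} (v : Fin m → Pt d) i → Span ℝ v (v i)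
  Span-basis v zero = (λ { zero → 1# ; (suc _) → 0# }) ,
    λ j → sym (trans (+-cong (*-identityˡ _) (linearCombination-0 (tail v) j)) (+-identityʳ _))
  Span-basis v (suc i) = Span-suc {v = v} (Span-basis (tail v) i)

  -- The Fredholm alternative. If v separates h from every bᵢ but b₀, subtract from h the multiple of b₀
  -- with the same product with v, and separate the result from the remaining bᵢ.
  span⊎separated : ∀ {n d} (b : Fin n → Pt d) h →
    Span ℝ b h ⊎ ∃[ v ] (∀ i → b i · v ≈ 0#) × h · v ≉ 0#
  span⊎separated {zero} b h with ≋𝟎⊎≉0 h
  ... | inj₁ e  = inj₁ ((λ ()) , e)
  ... | inj₂ ne = inj₂ (h , (λ ()) , ne)
  span⊎separated {suc n} b h with span⊎separated (tail b) h
  ... | inj₁ s = inj₁ (Span-suc {v = b} s)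
  ... | inj₂ (v , bv≈0 , hv≉0) with b zero · v Order.≟ 0#
  ...   | yes b₀v≈0 = inj₂ (v , (λ { zero → b₀v≈0 ; (suc i) → bv≈0 i }) , hv≉0)
  ...   | no b₀v≉0 with span⊎separated (tail b) (h ⊕ (- r) ⊙ b zero)
    where r = h · v * inv (b zero · v)
  ...     | inj₁ s = inj₁ (resp h′+rb≋h (addᵂ (Span-suc {v = b} s) (scaleᵂ r (Span-basis b zero))))
    where
    open Subspace (Span-subspace b)
    r = h · v * inv (b zero · v)
    h′+rb≋h : (h ⊕ (- r) ⊙ b zero) ⊕ r ⊙ b zero ≋ h
    h′+rb≋h j = solve 3 (λ h r b → h :+ (:- r) :* b :+ r :* b := h) refl (h j) r (b zero j)
  ...     | inj₂ (w , bw≈0 , h′w≉0) = inj₂ (slide (b zero) v w , bu≈0 , hu≉0)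
    where
    open import Relation.Binary.Reasoning.Setoid setoid
    r = h · v * inv (b zero · v)
    bu≈0 : ∀ i → b i · slide (b zero) v w ≈ 0#
    bu≈0 zero    = dot-slide-self (b zero) w b₀v≉0
    bu≈0 (suc i) = begin
      b (suc i) · slide (b zero) v w                                       ≈⟨ dot-slide (b (suc i)) (b zero) v w ⟩
      b (suc i) · w - b zero · w * inv (b zero · v) * b (suc i) · v
        ≈⟨ +-cong (bw≈0 i) (-‿cong (*-congˡ (bv≈0 i))) ⟩
      0# - b zero · w * inv (b zero · v) * 0#
        ≈⟨ solve 1 (λ a → :0 :- a :* :0 := :0) refl (b zero · w * inv (b zero · v)) ⟩
      0#                                                                   ∎
    hu≉0 : h · slide (b zero) v w ≉ 0#
    hu≉0 e = h′w≉0 (begin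
      (h ⊕ (- r) ⊙ b zero) · w                            ≈⟨ dot-⊕ˡ h ((- r) ⊙ b zero) w ⟩
      h · w + ((- r) ⊙ b zero) · w                        ≈⟨ +-congˡ (dot-⊙ˡ (- r) (b zero) w) ⟩
      h · w + (- r) * b zero · w
        ≈⟨ solve 4 (λ hw hv i bw → hw :+ (:- (hv :* i)) :* bw := hw :- bw :* i :* hv) refl (h · w) (h · v) (inv (b zero · v)) (b zero · w) ⟩
      h · w - b zero · w * inv (b zero · v) * h · v       ≈⟨ dot-slide h (b zero) v w ⟨
      h · slide (b zero) v w                              ≈⟨ e ⟩
      0#                                                  ∎)

  -- Gaussian elimination. Either the first vector vanishes and is by itself a relation, or one of
  -- its nonzero coordinates serves as a pivot to clear that coordinate from the other vectors,
  -- which lowers both `m` and `k` by one.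
  dependent : ∀ {m k} → k ℕ.< m → (M : Fin m → Pt k) →
    ∃[ c ] linearCombination ℝ c M ≋ 𝟎 × ∃[ i ] c i ≉ 0#
  dependent {suc m} {k} k<m M with Fin.any? (λ j → ¬? (M zero j Order.≟ 0#))
  ... | no none = (λ { zero → 1# ; (suc _) → 0# })
    , (λ j → trans (sym (proj₂ (Span-basis M zero) j)) (decidable-stable (M zero j Order.≟ 0#) λ ne → none (j , ne)))
    , zero , λ e → 0≉1 (sym e)
  dependent {suc m} {suc k} (ℕ.s≤s k<m) M | yes (j , M₀ⱼ≉0) with dependent k<m (λ i l → eliminated i (punchIn j l))
    where
    eliminated : Fin m → Pt (suc k)
    eliminated i = M (suc i) ⊕ (- (M (suc i) j * inv (M zero j))) ⊙ M zero
  -- The coefficient of the first vector collects the multiples of it that the elimination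
  -- subtracted from the others.
  ... | c , cN≋𝟎 , i , cᵢ≉0 = (λ { zero → - c · r ; (suc i) → c i }) , relation , suc i , cᵢ≉0
    where
    open import Relation.Binary.Reasoning.Setoid setoid
    r : Pt m
    r i = M (suc i) j * inv (M zero j)
    N : Fin m → Pt (suc k)
    N i = M (suc i) ⊕ (- r i) ⊙ M zero
    -- The recursion sees only the coordinates other than `j`; the coordinate `j` vanishes in each
    -- eliminated vector separately.
    N≈0 : ∀ l → linearCombination ℝ c N l ≈ 0#
    N≈0 l with j Fin.≟ l
    ... | no j≢l = ≡.subst (λ l → linearCombination ℝ c N l ≈ 0#) (Fin.punchIn-punchOut j≢l) (cN≋𝟎 (punchOut j≢l))
    ... | yes ≡.refl = trans (dot-congʳ c pivot) (trans (dot-comm c 𝟎) (dot-𝟎ˡ c (λ _ → refl)))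
      where
      pivot : ∀ i → N i j ≈ 0#
      pivot i = begin
        M (suc i) j + (- (M (suc i) j * inv (M zero j))) * M zero j
          ≈⟨ solve 3 (λ a b c → a :+ (:- (a :* b)) :* c := a :- a :* (c :* b)) refl (M (suc i) j) (inv (M zero j)) (M zero j) ⟩
        M (suc i) j - M (suc i) j * (M zero j * inv (M zero j))      ≈⟨ +-congˡ (-‿cong (*-congˡ (*-inv M₀ⱼ≉0))) ⟩
        M (suc i) j - M (suc i) j * 1#
          ≈⟨ solve 1 (λ a → a :- a :* :1 := :0) refl (M (suc i) j) ⟩
        0#                                                           ∎
    relation : ∀ l → (- c · r) * M zero l + linearCombination ℝ c (tail M) l ≈ 0#
    relation l = begin
      (- c · r) * M zero l + c · column
        ≈⟨ solve 3 (λ s m t → (:- s) :* m :+ t := t :+ (:- m) :* s) refl (c · r) (M zero l) (c · column) ⟩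
      c · column + (- M zero l) * c · r               ≈⟨ dot-along c column (- M zero l) r ⟨
      c · (column ⊕ (- M zero l) ⊙ r)
        ≈⟨ dot-congʳ c (λ i → solve 3 (λ a m r → a :+ (:- m) :* r := a :+ (:- r) :* m) refl (column i) (M zero l) (r i)) ⟩
      linearCombination ℝ c N l                       ≈⟨ N≈0 l ⟩
      0#                                              ∎
      where
      column : Pt m
      column i = M (suc i) l

  -- The coefficient vectors of the `v i` live in dimension `k` and so are dependent; the same
  -- relation then holds between the `v i`. Besides bounding ranks, it supplies the relation between
  -- three normals in a plane.
  dependent-in-span : ∀ {m k d} {v : Fin m → Pt d} {b : Fin k → Pt d} → k ℕ.< m → (∀ i → Span ℝ b (v i)) →
    ∃[ c ] linearCombination ℝ c v ≋ 𝟎 × ∃[ i ] c i ≉ 0#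
  dependent-in-span {m} {k} {v = v} {b} k<m v∈b =
    let c , cM≋𝟎 , nontrivial = dependent k<m M in c , relation c cM≋𝟎 , nontrivial
    where
    open import Relation.Binary.Reasoning.Setoid setoid
    M : Fin m → Pt k
    M i = proj₁ (v∈b i)
    relation : ∀ c → linearCombination ℝ c M ≋ 𝟎 → linearCombination ℝ c v ≋ 𝟎
    relation c cM≋𝟎 j = begin
      sum (λ i → c i * v i j)                              ≈⟨ sum-cong-≋ (λ i → *-congˡ {c i} (proj₂ (v∈b i) j)) ⟩
      sum (λ i → c i * sum (λ l → M i l * b l j))
        ≈⟨ sum-cong-≋ (λ i → *-distribˡ-sum (c i) (λ l → M i l * b l j)) ⟩
      sum (λ i → sum (λ l → c i * (M i l * b l j)))        ≈⟨ ∑-comm (λ i l → c i * (M i l * b l j)) ⟩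
      sum (λ l → sum (λ i → c i * (M i l * b l j)))
        ≈⟨ sum-cong-≋ (λ l → sum-cong-≋ (λ i → *-assoc (c i) (M i l) (b l j))) ⟨
      sum (λ l → sum (λ i → c i * M i l * b l j))
        ≈⟨ sum-cong-≋ (λ l → *-distribʳ-sum (b l j) (λ i → c i * M i l)) ⟨
      sum (λ l → linearCombination ℝ c M l * b l j)        ≈⟨ linearCombination-cong b cM≋𝟎 j ⟩
      sum (λ l → 0# * b l j)                               ≈⟨ linearCombination-0 b j ⟩
      0#                                                   ∎

  independent-in-span : ∀ {m k d} {v : Fin m → Pt d} {b : Fin k → Pt d} →
    LinearlyIndependent ℝ v → (∀ i → Span ℝ b (v i)) → m ≤ k
  independent-in-span {v = v} indep v∈b = ℕ.≮⇒≥ λ k<m →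
    let c , cv≋𝟎 , i , cᵢ≉0 = dependent-in-span {v = v} k<m v∈b in cᵢ≉0 (indep c cv≋𝟎 i)

-- Topology: open half-spaces and connectedness of convex sets

module Topology (ℝ : CompleteOrderedField) where
  open CompleteOrderedField ℝ hiding (zero) renaming (_≤_ to _≤ℝ_)
  open OrderedField ℝ
  open LinearAlgebra ℝ
  open IntegerCoefficients.RingSolver ℝ using (solve; _:=_; _:+_; _:*_; _:-_; :-_)
  open VectorEquality setoid using (_≋_)

  private
    Pt : ℕ → Set
    Pt = Point ℝ

    infix 9 _·_
    _·_ : ∀ {d} → Pt d → Pt d → Carrier
    _·_ = dot ℝ

  -- Neighbourhoods are handled through the difference from their centre, on which linear maps act
  -- directly; `Small⇒within` and `within⇒Small` translate to the cubes of `Open`.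
  record Small (ε z : Carrier) : Set where
    constructor between
    field
      lower : - ε < z
      upper : z < ε

  open Small

  abstract
    Small-resp : ∀ {ε z z′} → z ≈ z′ → Small ε z → Small ε z′
    Small-resp e (between p q) = between (<-respʳ e p) (<-respˡ e q)

    Small-neg : ∀ {ε z} → Small ε z → Small ε (- z)
    Small-neg {ε} (between p q) = between (neg-antimono-< q) (<-respʳ (solve 1 (λ ε → :- (:- ε) := ε) refl ε) (neg-antimono-< p))

    Small-0 : ∀ {ε z} → 0# < ε → z ≈ 0# → Small ε z
    Small-0 0<ε e = between (<-respʳ (sym e) (pos⇒-neg 0<ε)) (<-respˡ (sym e) 0<ε)

    Small-mono : ∀ {ε ε′ z} → ε < ε′ → Small ε z → Small ε′ z
    Small-mono ε<ε′ (between p q) = between (Order.trans (neg-antimono-< ε<ε′) p) (Order.trans q ε<ε′)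

    Small-pos : ∀ {ε z} → 0# < ε → 0# < z → z < ε → Small ε z
    Small-pos 0<ε 0<z z<ε = between (Order.trans (pos⇒-neg 0<ε) 0<z) z<ε

    Small-+ : ∀ {ε ε′ η z z′} → ε + ε′ ≈ η → Small ε z → Small ε′ z′ → Small η (z + z′)
    Small-+ {ε} {ε′} e (between p q) (between p′ q′) = between
      (<-respˡ (trans (solve 2 (λ a b → (:- a) :+ (:- b) := :- (a :+ b)) refl ε ε′) (-‿cong e)) (+-mono-< p p′))
      (<-respʳ e (+-mono-< q q′))

    half-pos : ∀ {x} → 0# < x → 0# < ½ * x
    half-pos = *-pos 0<½

    half+half : ∀ x → ½ * x + ½ * x ≈ x
    half+half x = trans (sym (distribʳ x ½ ½)) (trans (*-congʳ ½+½≈1) (*-identityˡ x))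

    half-< : ∀ {x} → 0# < x → ½ * x < x
    half-< {x} 0<x = difference-pos⇒<
      (trans (solve 1 (λ h → h := h :+ h :- h) refl (½ * x)) (+-congʳ (half+half x))) (half-pos 0<x)

    common : ∀ {a b} → 0# < a → 0# < b →
      ∃[ ε ] 0# < ε × (∀ {z} → Small ε z → Small a z) × (∀ {z} → Small ε z → Small b z)
    common {a} {b} 0<a 0<b with Order.compare a b
    ... | tri< a<b _ _ = a , 0<a , (λ z → z) , Small-mono a<b
    ... | tri≈ _ a≈b _ = a , 0<a , (λ z → z) , λ (between p q) → between (<-respˡ (-‿cong a≈b) p) (<-respʳ a≈b q)
    ... | tri> _ _ b<a = b , 0<b , Small-mono b<a , (λ z → z)

    scale-pos-small : ∀ {c η} → 0# < c → 0# < η → ∃[ ε ] 0# < ε × (∀ {z} → Small ε z → Small η (c * z))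
    scale-pos-small {c} {η} 0<c 0<η = inv c * η , *-pos (inv-pos 0<c) 0<η , λ (between p q) → between
      (<-respˡ (trans (solve 3 (λ c i η → c :* (:- (i :* η)) := :- (c :* i :* η)) refl c (inv c) η) (-‿cong cancel)) (*-monoˡ-< 0<c p))
      (<-respʳ (trans (sym (*-assoc c (inv c) η)) cancel) (*-monoˡ-< 0<c q))
      where
      cancel : c * inv c * η ≈ η
      cancel = trans (*-congʳ (*-inv (pos⇒≉0 0<c))) (*-identityˡ η)

    scale-small : ∀ c {η} → 0# < η → ∃[ ε ] 0# < ε × (∀ {z} → Small ε z → Small η (c * z))
    scale-small c {η} 0<η with Order.compare 0# c
    ... | tri< 0<c _ _ = scale-pos-small 0<c 0<η
    ... | tri≈ _ e _ = η , 0<η , λ _ → Small-0 0<η (trans (*-congʳ (sym e)) (zeroˡ _))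
    ... | tri> _ _ c<0 with scale-pos-small (neg⇒-pos c<0) 0<η
    ...   | ε , 0<ε , f = ε , 0<ε , λ {z} s →
      Small-resp (solve 2 (λ c z → :- ((:- c) :* z) := c :* z) refl c z) (Small-neg (f s))

    -- Half of the tolerance is given to the first coordinate, the other half to the remaining ones
    -- by induction.
    dot-small : ∀ {d} (h : Pt d) {η} → 0# < η → ∃[ ε ] 0# < ε × (∀ z → (∀ i → Small ε (z i)) → Small η (h · z))
    dot-small {zero}  h {η} 0<η = η , 0<η , λ _ _ → Small-0 0<η refl
    dot-small {suc d} h {η} 0<η with scale-small (h zero) (half-pos 0<η) | dot-small (tail h) (half-pos 0<η)
    ... | ε₁ , 0<ε₁ , f₁ | ε₂ , 0<ε₂ , f₂ with common 0<ε₁ 0<ε₂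
    ...   | ε , 0<ε , g₁ , g₂ =
      ε , 0<ε , λ z s → Small-+ (half+half η) (f₁ (g₁ (s zero))) (f₂ (tail z) (λ i → g₂ (s (suc i))))

    ⊙-small : ∀ {d} (v : Pt d) {η} → 0# < η → ∃[ ε ] 0# < ε × (∀ {t} → Small ε t → ∀ i → Small η (t * v i))
    ⊙-small {zero}  v {η} 0<η = η , 0<η , λ _ ()
    ⊙-small {suc d} v {η} 0<η with scale-small (v zero) 0<η | ⊙-small (tail v) 0<η
    ... | ε₁ , 0<ε₁ , f₁ | ε₂ , 0<ε₂ , f₂ with common 0<ε₁ 0<ε₂
    ...   | ε , 0<ε , g₁ , g₂ =
      ε , 0<ε , λ s → λ { zero → Small-resp (*-comm _ _) (f₁ (g₁ s)) ; (suc i) → f₂ (g₂ s) i }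

    Small⇒within : ∀ {ε x y z} → y ≈ x + z → Small ε z → x - ε < y × y < x + ε
    Small⇒within {x = x} e (between p q) = <-respʳ (sym e) (+-monoʳ-< x p) , <-respˡ (sym e) (+-monoʳ-< x q)

    within⇒Small : ∀ {ε x y z} → z ≈ y - x → x - ε < y × y < x + ε → Small ε z
    within⇒Small {ε} {x} e (p , q) = between
      (<-respʳ (sym e) (<-respˡ (solve 2 (λ x ε → x :- ε :- x := :- ε) refl x ε) (+-monoˡ-< (- x) p)))
      (<-respˡ (sym e) (<-respʳ (solve 2 (λ x ε → x :+ ε :- x := ε) refl x ε) (+-monoˡ-< (- x) q)))

    -- A point with the same coordinates as `x` lies in every cube about `x`, so open predicates
    -- respect pointwise equality although arbitrary predicates need not.
    Open-resp : ∀ {d} {U : Pred (Pt d) 0ℓ} → Open ℝ U → ∀ {x y} → x ≋ y → U x → U y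
    Open-resp open-U {x} {y} e x∈U with open-U x∈U
    ... | ε , 0<ε , f = f y λ i → Small⇒within (trans (sym (e i)) (sym (+-identityʳ _))) (Small-0 0<ε refl)

    positiveSide-open : ∀ {d} (h : Pt d) → Open ℝ (λ x → 0# < h · x)
    positiveSide-open h {x} 0<hx with dot-small h 0<hx
    ... | ε , 0<ε , f = ε , 0<ε , λ y near →
      difference-pos⇒< (sym (split y))
        (<⇒difference-pos (shift y) (lower (f (y ⊕ (- 1#) ⊙ x) λ i →
          within⇒Small (solve 2 (λ y x → y :+ (:- :1) :* x := y :- x) refl (y i) (x i)) (near i))))
      where
      split : ∀ y → h · y - 0# ≈ h · y
      split y = solve 1 (λ a → a :- :0 := a) refl (h · y)
      shift : ∀ y → h · y ≈ h · (y ⊕ (- 1#) ⊙ x) - (- h · x)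
      shift y = trans (solve 2 (λ a b → a := a :+ (:- :1) :* b :- (:- b)) refl (h · y) (h · x))
        (+-congʳ (sym (dot-along h y (- 1#) x)))

    Open-≐ : ∀ {d} {U V : Pred (Pt d) 0ℓ} → U ⊆ V → V ⊆ U → Open ℝ U → Open ℝ V
    Open-≐ U⊆V V⊆U open-U x∈V with open-U (V⊆U x∈V)
    ... | ε , 0<ε , f = ε , 0<ε , λ y near → U⊆V (f y near)

    negativeSide-open : ∀ {d} (h : Pt d) → Open ℝ (λ x → h · x < 0#)
    negativeSide-open h = Open-≐
      (λ {x} p → <-respˡ (solve 1 (λ a → :- (:- a) := a) refl (h · x)) (pos⇒-neg (<-respʳ (flip x) p)))
      (λ {x} p → <-respʳ (sym (flip x)) (neg⇒-pos p))
      (positiveSide-open ((- 1#) ⊙ h))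
      where
      flip : ∀ x → ((- 1#) ⊙ h) · x ≈ - h · x
      flip x = trans (dot-⊙ˡ (- 1#) h x) (solve 1 (λ a → (:- :1) :* a := :- a) refl (h · x))

  segment : ∀ {d} → Pt d → Pt d → Carrier → Pt d
  segment a b t = a ⊕ t ⊙ (b ⊕ (- 1#) ⊙ a)

  Convex : ∀ {d} → Pred (Pt d) 0ℓ → Set
  Convex C = ∀ {a b t} → C a → C b → 0# ≤ℝ t → t ≤ℝ 1# → C (segment a b t)

  abstract
    -- Follow the segment from a point of `U` to a point of `V`, and let `s` be the supremum of the
    -- parameters whose points lie in `U`. The point at `s` is not in `U`, since points of `U` would
    -- follow beyond `s` or, at the end of the segment, `U` and `V` would meet in `b`; it is not in
    -- `V`, since the bound could be lowered. This is where the completeness of the field enters.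
    convex⇒connected : ∀ {d} {C : Pred (Pt d) 0ℓ} → Convex C → Connected ℝ C
    convex⇒connected {d} {C} convex {U} {V} open-U open-V C⊆U∪V (a , a∈C , a∈U) (b , b∈C , b∈V) disjoint =
      [ s∉U , s∉V ]′ (C⊆U∪V (convex a∈C b∈C 0≤s s≤1))
      where
      p : Carrier → Pt d
      p = segment a b

      v : Pt d
      v = b ⊕ (- 1#) ⊙ a

      S : Pred Carrier 0ℓ
      S t = 0# ≤ℝ t × t ≤ℝ 1# × U (p t)

      0∈S : S 0#
      0∈S = inj₂ refl , inj₁ 0<1
          , Open-resp open-U (λ i → solve 2 (λ a v → a := a :+ :0 :* v) refl (a i) (v i)) a∈U

      sup : ∃[ s ] s ∈ UpperBound S × (∀ {b} → b ∈ UpperBound S → s ≤ℝ b)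
      sup = supremum S (0# , 0∈S) (1# , λ (_ , t≤1 , _) → t≤1)

      s : Carrier
      s = proj₁ sup

      s-upper : s ∈ UpperBound S
      s-upper = proj₁ (proj₂ sup)

      0≤s : 0# ≤ℝ s
      0≤s = s-upper 0∈S

      s≤1 : s ≤ℝ 1#
      s≤1 = proj₂ (proj₂ sup) λ (_ , t≤1 , _) → t≤1

      moved : ∀ t i → p t i ≈ p s i + (t - s) * v i
      moved t i = solve 4 (λ a v t s → a :+ t :* v := a :+ s :* v :+ (t :- s) :* v) refl (a i) (v i) t s

      near : ∀ {W : Pred (Pt d) 0ℓ} → Open ℝ W → W (p s) → ∃[ δ ] 0# < δ × (∀ t → Small δ (t - s) → W (p t))
      near open-W s∈W = let ε , 0<ε , f = open-W s∈W in pull f (⊙-small v 0<ε)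
        where
        pull : ∀ {ε} {W : Pred (Pt d) 0ℓ} → (∀ y → (∀ i → p s i - ε < y i × y i < p s i + ε) → W y) →
          ∃[ δ ] 0# < δ × (∀ {t} → Small δ t → ∀ i → Small ε (t * v i)) →
          ∃[ δ ] 0# < δ × (∀ t → Small δ (t - s) → W (p t))
        pull f (δ , 0<δ , g) = δ , 0<δ , λ t small → f (p t) λ i → Small⇒within (moved t i) (g small i)

      ≤⇒≯ : ∀ {x y} → x ≤ℝ y → ¬ y < x
      ≤⇒≯ (inj₁ x<y) y<x = Order.asym x<y y<x
      ≤⇒≯ (inj₂ x≈y) y<x = Order.irrefl (sym x≈y) y<x

      interior-in-U : ∀ {δ} → s < 1# → 0# < δ → ¬ (∀ t → Small δ (t - s) → U (p t))
      interior-in-U {δ} s<1 0<δ f = refute (common 0<δ (<⇒difference-pos refl s<1))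
        where
        refute : ¬ (∃[ e ] 0# < e × (∀ {z} → Small e z → Small δ z) × (∀ {z} → Small e z → Small (1# - s) z))
        refute (e , 0<e , g₁ , g₂) = ≤⇒≯ (s-upper (inj₁ 0<t , inj₁ t<1 , f t (Small-resp t-s (g₁ small)))) s<t
          where
          small : Small e (½ * e)
          small = Small-pos 0<e (half-pos 0<e) (half-< 0<e)
          t : Carrier
          t = s + ½ * e
          t-s : ½ * e ≈ t - s
          t-s = solve 2 (λ s h → h := s :+ h :- s) refl s (½ * e)
          s<t : s < t
          s<t = difference-pos⇒< t-s (half-pos 0<e)
          t<1 : t < 1#
          t<1 = <-respʳ (solve 1 (λ s → s :+ (:1 :- s) := :1) refl s) (+-monoʳ-< s (upper (g₂ small)))
          0<t : 0# < t
          0<t = [ (λ 0<s → Order.trans 0<s s<t) , (λ 0≈s → <-respˡ (sym 0≈s) s<t) ]′ 0≤s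

      s∉U : ¬ U (p s)
      s∉U s∈U = at-end s≤1
        where
        at-end : ¬ s ≤ℝ 1#
        at-end (inj₁ s<1) = let δ , 0<δ , f = near open-U s∈U in interior-in-U s<1 0<δ f
        at-end (inj₂ s≈1) = disjoint b (b∈C , Open-resp open-U end s∈U , b∈V)
          where
          end : p s ≋ b
          end i = trans (+-congˡ (*-congʳ s≈1)) (solve 2 (λ a b → a :+ :1 :* (b :+ (:- :1) :* a) := b) refl (a i) (b i))

      s∉V : ¬ V (p s)
      s∉V s∈V = let δ , 0<δ , f = near open-V s∈V in near-in-V 0<δ f
        where
        near-in-V : ∀ {δ} → 0# < δ → ¬ (∀ t → Small δ (t - s) → V (p t))
        -- Just below `s` the segment lies in `V`, so by disjointness no member of `S` is found
        -- there and `s - ½ * δ` would be a smaller upper bound.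
        near-in-V {δ} 0<δ f = ≤⇒≯ (proj₂ (proj₂ sup) s-½δ-upper) s-½δ<s
          where
          s-½δ<s : s - ½ * δ < s
          s-½δ<s = difference-pos⇒< (solve 2 (λ s h → h := s :- (s :- h)) refl s (½ * δ)) (half-pos 0<δ)

          in-V : ∀ {t} → s - ½ * δ < t → t ≤ℝ s → V (p t)
          in-V {t} _ (inj₂ t≈s) = f t (Small-0 0<δ (trans (+-congʳ t≈s) (-‿inverseʳ s)))
          in-V {t} lt (inj₁ t<s) = f t (Small-resp (solve 2 (λ s t → :- (s :- t) := t :- s) refl s t)
            (Small-neg (Small-pos 0<δ (<⇒difference-pos refl t<s)
              (Order.trans (<-respʳ (solve 2 (λ s h → s :- (s :- h) := h) refl s (½ * δ))
                (+-monoʳ-< s (neg-antimono-< lt))) (half-< 0<δ)))))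

          s-½δ-upper : s - ½ * δ ∈ UpperBound S
          s-½δ-upper {t} t∈S@(0≤t , t≤1 , t∈U) with Order.compare t (s - ½ * δ)
          ... | tri< lt _ _ = inj₁ lt
          ... | tri≈ _ e _ = inj₂ e
          ... | tri> _ _ gt = contradiction (convex a∈C b∈C 0≤t t≤1 , t∈U , in-V gt (s-upper t∈S)) (disjoint (p t))

-- Paths with explicit vertex lists

module _ {ℓ₁ ℓ₂ : Level} {P : Set ℓ₁} where

  -- The vertex list is an index, so that distinctness, completeness and length can be stated about
  -- that list independently of the edges.
  data Path (R : Rel P ℓ₂) : P → List P → P → Set (ℓ₁ Level.⊔ ℓ₂) where
    [_] : ∀ x → Path R x (x ∷ []) x
    _∷_ : ∀ {x y z xs} → R x y → Path R y xs z → Path R x (x ∷ xs) z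

  _▸_∷_ : ∀ {R a b c d xs ys} → Path R a xs b → R b c → Path R c ys d → Path R a (xs ++ ys) d
  [ x ]   ▸ r ∷ q = r ∷ q
  (s ∷ p) ▸ r ∷ q = s ∷ (p ▸ r ∷ q)

  path-first : ∀ {R a xs b} → Path R a xs b → ∀ {j} → toℕ j ≡ 0 → lookup xs j ≡ a
  path-first [ x ]   {zero} _ = ≡.refl
  path-first (_ ∷ _) {zero} _ = ≡.refl

  path-last : ∀ {R a xs b} → Path R a xs b → ∀ {i} → suc (toℕ i) ≡ length xs → lookup xs i ≡ b
  path-last [ x ]         {zero}  _ = ≡.refl
  path-last (_ ∷ [ _ ])   {zero}  ()
  path-last (_ ∷ (_ ∷ _)) {zero}  ()
  path-last (_ ∷ p)       {suc i} e = path-last p (ℕ.suc-injective e)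

  path-step : ∀ {R a xs b} → Path R a xs b → ∀ {i j} → toℕ j ≡ suc (toℕ i) → R (lookup xs i) (lookup xs j)
  path-step [ x ]   {zero}  {zero}  ()
  path-step {R} (r ∷ p) {zero}  {suc j} e = ≡.subst (R _) (≡.sym (path-first p (ℕ.suc-injective e))) r
  path-step (r ∷ p) {suc i} {suc j} e = path-step p (ℕ.suc-injective e)

  path-cyclic : ∀ {R a xs b} → Path R a xs b → R b a → ∀ {i j} → CyclicNext i j → R (lookup xs i) (lookup xs j)
  path-cyclic p r (step e) = path-step p e
  path-cyclic {R} p r (wrap e e′) = ≡.subst₂ R (≡.sym (path-last p e)) (≡.sym (path-first p e′)) r

  lookup-injective : ∀ {S : Rel P ℓ₂} {xs} → Symmetric S → AllPairs (λ x y → ¬ S x y) xs →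
    ∀ i j → S (lookup xs i) (lookup xs j) → i ≡ j
  lookup-injective sym (_  ∷ _)  zero    zero    s = ≡.refl
  lookup-injective sym (ns ∷ _)  zero    (suc j) s = contradiction s (All.lookup ns (∈-lookup j))
  lookup-injective sym (ns ∷ _)  (suc i) zero    s = contradiction (sym s) (All.lookup ns (∈-lookup i))
  lookup-injective sym (_  ∷ ps) (suc i) (suc j) s = ≡.cong suc (lookup-injective sym ps i j s)

-- Regions as sign classes of points

module Cells (ℝ : CompleteOrderedField) where
  open CompleteOrderedField ℝ hiding (zero) renaming (_≤_ to _≤ℝ_)
  open OrderedField ℝ
  open LinearAlgebra ℝ
  open Topology ℝ
  open Arrangement
  open Hyperplane
  open Region
  open IntegerCoefficients.RingSolver ℝ using (solve; _:=_; _:+_; _:*_; _:-_; :-_)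

  side : ∀ {d} → Hyperplane ℝ d → Point ℝ d → Carrier
  side H x = dot ℝ (normal H) x

  module _ {d : ℕ} where

    infix 4 _∈ᴬ_
    _∈ᴬ_ : Hyperplane ℝ d → Arrangement ℝ d → Set
    H ∈ᴬ A = _∈ₕ_ ℝ H (members A)

    ∈ᴬ-resp : ∀ {H K} A → _≈ₕ_ ℝ H K → H ∈ᴬ A → K ∈ᴬ A
    ∈ᴬ-resp {H} {K} A = Membership.∈-resp-≈ (hyperplanes ℝ d) {members A} {H} {K}

    ≈ₕ-sym : ∀ (H K : Hyperplane ℝ d) → _≈ₕ_ ℝ H K → _≈ₕ_ ℝ K H
    ≈ₕ-sym H K (H⊆K , K⊆H) = (λ {x} → K⊆H {x}) , (λ {x} → H⊆K {x})

    members-are-members : ∀ A → All (_∈ᴬ A) (members A)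
    members-are-members A = All.tabulate (Any.map λ { ≡.refl → (λ {x} p → p) , (λ {x} p → p) })

    abstract
      -- The normal of `H` is itself a direction off `H`, so the forms are proportional; the factor
      -- is nonzero because the normal of `K` is. Hence an inclusion of hyperplanes is already an
      -- equality, and signs transfer between equal hyperplanes.
      ⊆⇒scaled : ∀ (H K : Hyperplane ℝ d) → ⟦_⟧ ℝ H ⊆ ⟦_⟧ ℝ K →
        ∃[ c ] c ≉ 0# × ∀ x → side K x ≈ c * side H x
      ⊆⇒scaled H K H⊆K = scaled (kernel⊆⇒proportional (pos⇒≉0 (≉𝟎⇒dot-self-pos (normal≉0 H))) λ x → H⊆K {x})
        where
        scaled : ∃[ c ] (∀ x → side K x ≈ c * side H x) → ∃[ c ] c ≉ 0# × ∀ x → side K x ≈ c * side H x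
        scaled (c , e) = c
          , (λ c≈0 → normal≉0 K (dot-vanishes⇒≋𝟎 λ x → trans (e x) (trans (*-congʳ c≈0) (zeroˡ _))))
          , e

      ⊆⇒≈ₕ : ∀ (H K : Hyperplane ℝ d) → ⟦_⟧ ℝ H ⊆ ⟦_⟧ ℝ K → _≈ₕ_ ℝ H K
      ⊆⇒≈ₕ H K H⊆K = let c , c≉0 , e = ⊆⇒scaled H K H⊆K in
        H⊆K , λ {x} Kx≈0 → *-cancelˡ-0 c≉0 (trans (sym (e x)) Kx≈0)

      ≈ₕ-∼ : ∀ H K → _≈ₕ_ ℝ H K → ∀ {x y : Point ℝ d} → side H x ∼ side H y → side K x ∼ side K y
      ≈ₕ-∼ H K H≈K {x} {y} p = let c , c≉0 , e = ⊆⇒scaled H K (proj₁ H≈K) in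
        ∼-respˡ (sym (e x)) (∼-respʳ (sym (e y)) (∼-*-scale c≉0 p))

    -- For `x` off the arrangement this is the region containing `x`, with no sign vector chosen;
    -- for `x` on one of the hyperplanes it is empty.
    Cell : Arrangement ℝ d → Point ℝ d → Pred (Point ℝ d) 0ℓ
    Cell A x y = ∀ H → H ∈ᴬ A → side H x ∼ side H y

    Off : Arrangement ℝ d → Pred (Point ℝ d) 0ℓ
    Off A x = ∀ H → H ∈ᴬ A → side H x ≉ 0#

    Adj : Arrangement ℝ d → Rel (Point ℝ d) 0ℓ
    Adj A x y = ∃[ H ] H ∈ᴬ A × side H x ≁ side H y ×
      (∀ K → K ∈ᴬ A → side K x ≁ side K y → _≈ₕ_ ℝ H K)

    Cell-refl : ∀ A {x} → Off A x → Cell A x x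
    Cell-refl A x∈A H H∈A = ∼-refl (x∈A H H∈A)

    Cell-sym : ∀ A → Symmetric (Cell A)
    Cell-sym A p H H∈A = ∼-sym (p H H∈A)

    Cell-trans : ∀ A {x y z} → Cell A x y → Cell A y z → Cell A x z
    Cell-trans A p q H H∈A = ∼-trans (p H H∈A) (q H H∈A)

    abstract
      -- Along a segment the product with `side H x` is a weighted mean of two positive numbers. The
      -- ends are treated apart because one of the weights vanishes there.
      Cell-convex : ∀ A x → Convex (Cell A x)
      Cell-convex A x {a} {b} {t} a∈C b∈C 0≤t t≤1 H H∈A =
        <-respʳ (sym expand) (weighted 0≤t t≤1 (a∈C H H∈A) (b∈C H H∈A))
        where
        open import Relation.Binary.Reasoning.Setoid setoid

        expand : side H x * side H (segment a b t) ≈ (1# - t) * (side H x * side H a) + t * (side H x * side H b)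
        expand = begin
          side H x * side H (segment a b t)                              ≈⟨ *-congˡ (dot-along (normal H) a t _) ⟩
          side H x * (side H a + t * side H (b ⊕ (- 1#) ⊙ a))
            ≈⟨ *-congˡ (+-congˡ (*-congˡ (dot-along (normal H) b (- 1#) a))) ⟩
          side H x * (side H a + t * (side H b + (- 1#) * side H a))
            ≈⟨ solve 4 (λ x a b t → x :* (a :+ t :* (b :+ (:- :1) :* a)) := (:1 :- t) :* (x :* a) :+ t :* (x :* b)) refl (side H x) (side H a) (side H b) t ⟩
          (1# - t) * (side H x * side H a) + t * (side H x * side H b)   ∎

        weighted : ∀ {t u w} → 0# ≤ℝ t → t ≤ℝ 1# → 0# < u → 0# < w → 0# < (1# - t) * u + t * w
        weighted {t} {u} {w} (inj₂ 0≈t) _ 0<u 0<w =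
          <-respʳ (trans (solve 2 (λ u w → u := (:1 :- :0) :* u :+ :0 :* w) refl u w)
            (+-cong (*-congʳ (+-congˡ (-‿cong 0≈t))) (*-congʳ 0≈t))) 0<u
        weighted {t} {u} {w} (inj₁ _) (inj₂ t≈1) 0<u 0<w =
          <-respʳ (trans (solve 2 (λ u w → w := (:1 :- :1) :* u :+ :1 :* w) refl u w)
            (+-cong (*-congʳ (+-congˡ (-‿cong (sym t≈1)))) (*-congʳ (sym t≈1)))) 0<w
        weighted (inj₁ 0<t) (inj₁ t<1) 0<u 0<w = +-pos (*-pos (<⇒difference-pos refl t<1) 0<u) (*-pos 0<t 0<w)

      -- A hyperplane with points of `Q` on either side would cut `Q`, which avoids it, into two
      -- disjoint nonempty parts by open half-spaces.
      connected⊆Cell : ∀ A {Q : Pred (Point ℝ d) 0ℓ} {x} → Q ⊆ Complement ℝ A → Connected ℝ Q → Q x → Q ⊆ Cell A x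
      connected⊆Cell A {Q} {x} Q⊆A connected x∈Q {y} y∈Q H H∈A =
        [ (λ p → p) , (λ p → contradiction (≁⇒cases p) separated) ]′ (∼⊎≁ (Q⊆A x∈Q {H} H∈A) (Q⊆A y∈Q {H} H∈A))
        where
        sides : Q ⊆ (λ z → side H z < 0# ⊎ 0# < side H z)
        sides {z} z∈Q with Order.compare (side H z) 0#
        ... | tri< p _ _ = inj₁ p
        ... | tri≈ _ e _ = contradiction e (Q⊆A z∈Q {H} H∈A)
        ... | tri> _ _ p = inj₂ p

        cut : Satisfiable (λ z → Q z × side H z < 0#) → ¬ Satisfiable (λ z → Q z × 0# < side H z)
        cut p q = connected (negativeSide-open (normal H)) (positiveSide-open (normal H)) (λ {z} → sides {z}) p q
          λ _ (_ , neg , pos) → Order.asym neg pos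

        separated : ¬ ((0# < side H x × side H y < 0#) ⊎ (side H x < 0# × 0# < side H y))
        separated (inj₁ (p , q)) = cut (y , y∈Q , q) (x , x∈Q , p)
        separated (inj₂ (p , q)) = cut (x , x∈Q , p) (y , y∈Q , q)

      Cell⊆Complement : ∀ A x → Cell A x ⊆ Complement ℝ A
      Cell⊆Complement A x p {H} H∈A = ∼⇒≉0ʳ (p H H∈A)

      Cell-isComponent : ∀ A {x} → Off A x → IsConnectedComponent ℝ (Complement ℝ A) (Cell A x)
      Cell-isComponent A {x} x∈A = record
        { nonempty  = x , Cell-refl A x∈A
        ; contained = λ {y} → Cell⊆Complement A x {y}
        ; connected = convex⇒connected (Cell-convex A x)
        ; maximal   = λ Q⊆A connected C⊆Q → connected⊆Cell A Q⊆A connected (C⊆Q (Cell-refl A x∈A))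
        }

    region : ∀ A x → Off A x → Region ℝ A
    region A x x∈A = record { points = Cell A x ; isComponent = Cell-isComponent A x∈A }

    abstract
      -- Connectedness puts the region inside the cell; its maximality then puts the cell, which is
      -- convex, inside the region.
      region≐Cell : ∀ A (R : Region ℝ A) {x} → points R x → Cell A x ≐ points R
      region≐Cell A R {x} x∈R =
        maximal (λ {y} → Cell⊆Complement A x {y}) (convex⇒connected (Cell-convex A x)) R⊆C , R⊆C
        where
        open IsConnectedComponent (isComponent R)
        R⊆C : points R ⊆ Cell A x
        R⊆C = connected⊆Cell A contained connected x∈R

      Cell-adjacent : ∀ A {x y} → Off A x → Off A y → Adj A x y →
        SeparatedByExactlyOne ℝ A (Cell A x) (Cell A y)
      Cell-adjacent A {x} {y} x∈A y∈A (H , H∈A , p , unique) =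
        H , (H∈A , separates (≁⇒cases p)) , λ {K} (K∈A , s) → unique K K∈A (opposite K s)
        where
        separates : (0# < side H x × side H y < 0#) ⊎ (side H x < 0# × 0# < side H y) → Separates ℝ H (Cell A x) (Cell A y)
        separates (inj₁ (p , q)) = inj₁ ((λ c → ∼-pos p (c H H∈A)) , (λ c → ∼-neg q (c H H∈A)))
        separates (inj₂ (p , q)) = inj₂ ((λ c → ∼-neg p (c H H∈A)) , (λ c → ∼-pos q (c H H∈A)))

        opposite : ∀ K → Separates ℝ K (Cell A x) (Cell A y) → side K x ≁ side K y
        opposite K (inj₁ (f , g)) = pos-≁-neg (f (Cell-refl A x∈A)) (g (Cell-refl A y∈A))
        opposite K (inj₂ (f , g)) = ≁-sym (pos-≁-neg (g (Cell-refl A y∈A)) (f (Cell-refl A x∈A)))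

    -- A Hamiltonian cycle on representatives of the regions, with no lower bound on the length: the
    -- two sides of one hyperplane form a tour whose closing edge repeats its only edge. Evenness
    -- belongs to the data because lifting depends on it to close up.
    record Tour (A : Arrangement ℝ d) : Set where
      field
        {first last} : Point ℝ d
        visits       : List (Point ℝ d)
        path         : Path (Adj A) first visits last
        closing      : Adj A last first
        complement   : All (Off A) visits
        distinct     : AllPairs (λ x y → ¬ Cell A x y) visits
        complete     : ∀ y → Off A y → Any (λ x → Cell A x y) visits
        even         : 2 ∣ length visits

    module _ {A : Arrangement ℝ d} (T : Tour A) (3≤length : 3 ≤ length (Tour.visits T)) where
      open Tour T

      private
        vertex : Fin (length visits) → Region ℝ A
        vertex i = region A (lookup visits i) (All.lookup complement (∈-lookup i))

        injective : ∀ i j → points (vertex i) ≐ points (vertex j) → i ≡ j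
        injective i j (f , _) = lookup-injective {S = Cell A} (Cell-sym A) distinct i j
          (Cell-sym A (f {lookup visits i} (Cell-refl A (All.lookup complement (∈-lookup i)))))

        surjective : ∀ R → ∃[ i ] ∀ {j} → j ≡ i → points (vertex j) ≐ points R
        surjective R = let y , y∈R = IsConnectedComponent.nonempty (isComponent R)
                           found = complete y (λ H → IsConnectedComponent.contained (isComponent R) y∈R {H})
                           i = Any.index found
                           xᵢ∼y = Any.lookup-index found
                           Cy⊆R , R⊆Cy = region≐Cell A R y∈R
          in i , λ { ≡.refl → (λ {z} c → Cy⊆R {z} (Cell-trans A (Cell-sym A xᵢ∼y) c))
                            , (λ {z} z∈R → Cell-trans A xᵢ∼y (R⊆Cy z∈R)) }

      hamiltonianCycle : HamiltonianCycle (regionGraph ℝ A) (length visits)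
      hamiltonianCycle = record
        { length≥3  = 3≤length
        ; vertex    = vertex
        ; bijective = (λ {i} {j} → injective i j) , surjective
        ; adjacent  = λ {i} {j} next → Cell-adjacent A
            (All.lookup complement (∈-lookup i)) (All.lookup complement (∈-lookup j)) (path-cyclic path closing next)
        }

-- Intervals cut out of the line by finitely many values

module Gaps (ℝ : CompleteOrderedField) where
  open CompleteOrderedField ℝ hiding (zero; _≤_)
  open OrderedField ℝ
  open IntegerCoefficients.RingSolver ℝ using (solve; _:=_; _:+_; _:*_; _:-_; :-_)

  -- Discards t if a value equal to it is already present.
  insert : Carrier → List Carrier → List Carrier
  insert t []       = t ∷ []
  insert t (u ∷ us) with Order.compare t u
  ... | tri< _ _ _ = t ∷ u ∷ us
  ... | tri≈ _ _ _ = u ∷ us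
  ... | tri> _ _ _ = u ∷ insert t us

  sort : List Carrier → List Carrier
  sort = foldr insert []

  module _ {P : Pred Carrier 0ℓ} where

    All-insert : ∀ {t us} → P t → All P us → All P (insert t us)
    All-insert {t} {[]}     p []       = p ∷ []
    All-insert {t} {u ∷ us} p (q ∷ qs) with Order.compare t u
    ... | tri< _ _ _ = p ∷ q ∷ qs
    ... | tri≈ _ _ _ = q ∷ qs
    ... | tri> _ _ _ = q ∷ All-insert p qs

    All-sort : ∀ {ts} → All P ts → All P (sort ts)
    All-sort []       = []
    All-sort (p ∷ ps) = All-insert p (All-sort ps)

    -- `insert` may have discarded `t` in favour of an equal entry, whence the condition that `P`
    -- respects equality.
    All-uninsert : (∀ {t u} → t ≈ u → P u → P t) → ∀ {t us} → All P (insert t us) → P t × All P us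
    All-uninsert resp {t} {[]}     (p ∷ []) = p , []
    All-uninsert resp {t} {u ∷ us} ps with Order.compare t u
    All-uninsert resp (p ∷ ps) | tri< _ _ _   = p , ps
    All-uninsert resp (p ∷ ps) | tri≈ _ t≈u _ = resp t≈u p , p ∷ ps
    All-uninsert resp (p ∷ ps) | tri> _ _ _   = let q , qs = All-uninsert resp ps in q , p ∷ qs

    All-unsort : (∀ {t u} → t ≈ u → P u → P t) → ∀ ts → All P (sort ts) → All P ts
    All-unsort resp []       _  = []
    All-unsort resp (t ∷ ts) ps = let q , qs = All-uninsert resp ps in q ∷ All-unsort resp ts qs

  Ascending : List Carrier → Set
  Ascending = AllPairs _<_

  insert-ascending : ∀ t {us} → Ascending us → Ascending (insert t us)
  insert-ascending t {[]}     [] = [] ∷ []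
  insert-ascending t {u ∷ us} (u<us ∷ asc) with Order.compare t u
  ... | tri< t<u _ _ = (t<u ∷ All.map (Order.trans t<u) u<us) ∷ u<us ∷ asc
  ... | tri≈ _ _ _   = u<us ∷ asc
  ... | tri> _ _ u<t = All-insert u<t u<us ∷ insert-ascending t asc

  sort-ascending : ∀ ts → Ascending (sort ts)
  sort-ascending []       = []
  sort-ascending (t ∷ ts) = insert-ascending t (sort-ascending ts)

  length-insert : ∀ {t us} → All (t ≉_) us → length (insert t us) ≡ suc (length us)
  length-insert {t} {[]}     _ = ≡.refl
  length-insert {t} {u ∷ us} (t≉u ∷ t≉us) with Order.compare t u
  ... | tri< _ _ _   = ≡.refl
  ... | tri≈ _ t≈u _ = contradiction t≈u t≉u
  ... | tri> _ _ _   = ≡.cong suc (length-insert t≉us)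

  length-sort : ∀ {ts} → AllPairs _≉_ ts → length (sort ts) ≡ length ts
  length-sort []            = ≡.refl
  length-sort (t≉ts ∷ uniq) = ≡.trans (length-insert (All-sort t≉ts)) (≡.cong suc (length-sort uniq))

  -- Sample points of the intervals above t cut out by the ascending list t ∷ ts.
  gapsAbove : Carrier → List Carrier → List Carrier
  gapsAbove t []        = t + 1# ∷ []
  gapsAbove t (t′ ∷ ts) = midpoint t t′ ∷ gapsAbove t′ ts

  gaps : List Carrier → List Carrier
  gaps []       = 0# ∷ []
  gaps (t ∷ ts) = t - 1# ∷ gapsAbove t ts

  length-gapsAbove : ∀ t ts → length (gapsAbove t ts) ≡ suc (length ts)
  length-gapsAbove t []        = ≡.refl
  length-gapsAbove t (t′ ∷ ts) = ≡.cong suc (length-gapsAbove t′ ts)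

  length-gaps : ∀ ts → length (gaps ts) ≡ suc (length ts)
  length-gaps []       = ≡.refl
  length-gaps (t ∷ ts) = ≡.cong suc (length-gapsAbove t ts)

  -- Shaped after the recursion of `gapsAbove`: two consecutive samples produce a `here` at the
  -- entry between them, and each earlier entry of the list adds a `there`.
  data Crosses (s s′ : Carrier) : List Carrier → Set where
    here  : ∀ {t ts} → s < t → t < s′ → All (s′ <_) ts → Crosses s s′ (t ∷ ts)
    there : ∀ {t ts} → t < s → t < s′ → Crosses s s′ ts → Crosses s s′ (t ∷ ts)

  SameSide : Carrier → Carrier → Carrier → Set
  SameSide s s′ t = (t < s × t < s′) ⊎ (s < t × s′ < t)

  crosses-one : ∀ {P : Pred Carrier 0ℓ} {s s′ ts} → Ascending ts → All P ts → Crosses s s′ ts →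
    ∃[ t ] P t × s < t × t < s′ × All (λ u → SameSide s s′ u ⊎ u ≈ t) ts
  crosses-one (_ ∷ _) (p ∷ ps) (here s<t t<s′ s′<ts) =
    _ , p , s<t , t<s′ , inj₂ refl ∷ All.map (λ s′<u → inj₁ (inj₂ (Order.trans (Order.trans s<t t<s′) s′<u , s′<u))) s′<ts
  crosses-one (_ ∷ asc) (_ ∷ ps) (there t<s t<s′ c) =
    let u , p , s<u , u<s′ , others = crosses-one asc ps c
    in u , p , s<u , u<s′ , inj₁ (inj₁ (t<s , t<s′)) ∷ others

  Between : Carrier → Carrier → Carrier → Set
  Between s s′ t = s < t × t < s′

  Avoids : Carrier → Carrier → Set
  Avoids s t = t < s ⊎ s < t

  <-+1 : ∀ t → t < t + 1#
  <-+1 t = difference-pos⇒< (solve 1 (λ t → :1 := t :+ :1 :- t) refl t) 0<1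

  -1-< : ∀ t → t - 1# < t
  -1-< t = difference-pos⇒< (solve 1 (λ t → :1 := t :- (t :- :1)) refl t) 0<1

  gapsAbove-> : ∀ t {ts} → All (t <_) ts → Ascending ts → All (t <_) (gapsAbove t ts)
  gapsAbove-> t []           []       = <-+1 t ∷ []
  gapsAbove-> t (t<t′ ∷ _) (t′< ∷ asc) =
    <-midpoint t<t′ ∷ All.map (Order.trans t<t′) (gapsAbove-> _ t′< asc)

  gapsAbove-avoid : ∀ t {ts} → All (t <_) ts → Ascending ts → All (λ s → All (Avoids s) ts) (gapsAbove t ts)
  gapsAbove-avoid t []         []          = [] ∷ []
  gapsAbove-avoid t (t<t′ ∷ _) (t′< ∷ asc) =
    (inj₂ (midpoint-< t<t′) ∷ All.map (λ t′<u → inj₂ (Order.trans (midpoint-< t<t′) t′<u)) t′<)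
    ∷ All.zipWith (λ (t′<s , avoid) → inj₁ t′<s ∷ avoid) (gapsAbove-> _ t′< asc , gapsAbove-avoid _ t′< asc)

  gapsAbove-separated : ∀ t {ts} → All (t <_) ts → Ascending ts →
    AllPairs (λ s s′ → Any (Between s s′) ts) (gapsAbove t ts)
  gapsAbove-separated t []         []          = [] ∷ []
  gapsAbove-separated t (t<t′ ∷ _) (t′< ∷ asc) =
    All.map (λ t′<s → here (midpoint-< t<t′ , t′<s)) (gapsAbove-> _ t′< asc)
    ∷ AllPairs.map there (gapsAbove-separated _ t′< asc)

  path-map⁺ : ∀ {R S : Carrier → Carrier → Set} {P : Pred Carrier 0ℓ} {a b ss} →
    (∀ {s s′} → P s → P s′ → R s s′ → S s s′) → All P ss → Path R a ss b → Path S a ss b × P a × P b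
  path-map⁺ f (p ∷ []) [ x ]   = [ x ] , p , p
  path-map⁺ f (p ∷ ps) (r ∷ q) = let q′ , p′ , pᵇ = path-map⁺ f ps q in (f p p′ r ∷ q′) , p , pᵇ

  -- The bounds on `a` and `b` are what places the two ends of a fibre on the extreme sides of `A₁`.
  Traversal : List Carrier → List Carrier → Set
  Traversal ts ss = ∃[ a ] ∃[ b ] Path (λ s s′ → Crosses s s′ ts) a ss b × All (a <_) ts × All (_< b) ts

  traversal-extend : ∀ {s t ts ss} → s < t → All (t <_) ss → All (t <_) ts → Traversal ts ss →
    Traversal (t ∷ ts) (s ∷ ss)
  traversal-extend {s} {t} s<t t<ss t<ts (a , b , p , a<ts , ts<b) =
    let q , t<a , t<b = path-map⁺ (λ t<u t<u′ c → there t<u t<u′ c) t<ss p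
    in s , b , here s<t t<a a<ts ∷ q , (s<t ∷ All.map (Order.trans s<t) t<ts) , (t<b ∷ ts<b)

  gapsAbove-traversal : ∀ t {ts} → All (t <_) ts → Ascending ts → Traversal ts (gapsAbove t ts)
  gapsAbove-traversal t []         []          = _ , _ , [ _ ] , [] , []
  gapsAbove-traversal t (t<t′ ∷ _) (t′< ∷ asc) =
    traversal-extend (midpoint-< t<t′) (gapsAbove-> _ t′< asc) t′< (gapsAbove-traversal _ t′< asc)

  gaps-traversal : ∀ {ts} → Ascending ts → Traversal ts (gaps ts)
  gaps-traversal []         = _ , _ , [ _ ] , [] , []
  gaps-traversal (t< ∷ asc) = traversal-extend (-1-< _) (gapsAbove-> _ t< asc) t< (gapsAbove-traversal _ t< asc)

  gaps-avoid : ∀ {ts} → Ascending ts → All (λ s → All (Avoids s) ts) (gaps ts)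
  gaps-avoid []         = [] ∷ []
  gaps-avoid (t< ∷ asc) =
    (inj₂ (-1-< _) ∷ All.map (λ t<u → inj₂ (Order.trans (-1-< _) t<u)) t<)
    ∷ All.zipWith (λ (t<s , avoid) → inj₁ t<s ∷ avoid) (gapsAbove-> _ t< asc , gapsAbove-avoid _ t< asc)

  gaps-separated : ∀ {ts} → Ascending ts → AllPairs (λ s s′ → Any (Between s s′) ts) (gaps ts)
  gaps-separated []         = [] ∷ []
  gaps-separated (t< ∷ asc) =
    All.map (λ t<s → here (-1-< _ , t<s)) (gapsAbove-> _ t< asc)
    ∷ AllPairs.map there (gapsAbove-separated _ t< asc)

  -- In `fibre-complete`, `L` holds for the crossings that a given point has behind it and `U` for
  -- those still ahead of it.
  Splits : Pred Carrier 0ℓ → Pred Carrier 0ℓ → Carrier → Carrier → Set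
  Splits L U s t = (L t × t < s) ⊎ (U t × s < t)

  module _ {L U : Pred Carrier 0ℓ} (L<U : ∀ {t u} → L t → U u → t < u) where

    all-upper : ∀ {s t ts} → s < t → U t → All (t <_) ts → All (λ u → L u ⊎ U u) ts → All (Splits L U s) ts
    all-upper s<t ut t<ts lu = All.zipWith upper (t<ts , lu)
      where
      upper : ∀ {u} → _ < u × (L u ⊎ U u) → Splits L U _ u
      upper (t<u , inj₁ l) = contradiction (Order.trans t<u (L<U l ut)) <-irrefl
      upper (t<u , inj₂ r) = inj₂ (r , Order.trans s<t t<u)

    -- The sample wanted is the one just before the first entry in `U`, or the last one if there is
    -- no such entry. No later entry can fall back into `L`, because `L` lies below `U`.
    gapsAbove-locate : ∀ t {ts} → All (t <_) ts → Ascending ts → All (λ t → L t ⊎ U t) ts →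
      Any (λ s → t < s × All (Splits L U s) ts) (gapsAbove t ts)
    gapsAbove-locate t []         []          []           = here (<-+1 t , [])
    gapsAbove-locate t (t<t′ ∷ _) (t′< ∷ asc) (inj₂ u ∷ lu) =
      here (<-midpoint t<t′ , inj₂ (u , midpoint-< t<t′) ∷ all-upper (midpoint-< t<t′) u t′< lu)
    gapsAbove-locate t (t<t′ ∷ _) (t′< ∷ asc) (inj₁ l ∷ lu) =
      there (Any.map (λ (t′<s , splits) → Order.trans t<t′ t′<s , inj₁ (l , t′<s) ∷ splits) (gapsAbove-locate _ t′< asc lu))

    gaps-locate : ∀ {ts} → Ascending ts → All (λ t → L t ⊎ U t) ts → Any (λ s → All (Splits L U s) ts) (gaps ts)
    gaps-locate []         []            = here []
    gaps-locate (t< ∷ asc) (inj₂ u ∷ lu) = here (inj₂ (u , -1-< _) ∷ all-upper (-1-< _) u t< lu)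
    gaps-locate (t< ∷ asc) (inj₁ l ∷ lu) =
      there (Any.map (λ (t<s , splits) → inj₁ (l , t<s) ∷ splits) (gapsAbove-locate _ t< asc lu))

-- Fibres over the regions of `A₀`

module Fibres (ℝ : CompleteOrderedField) where
  open CompleteOrderedField ℝ hiding (zero; _≤_)
  open OrderedField ℝ
  open LinearAlgebra ℝ
  open Cells ℝ
  open Gaps ℝ
  open VectorEquality setoid using (_≋_)
  open Arrangement
  open Hyperplane
  open IntegerCoefficients.RingSolver ℝ using (solve; _:=_; _:+_; _:*_; _:-_; :-_)

  module _ {d} {A A₀ A₁ : Arrangement ℝ d} (A=A₀⊎A₁ : IsDisjointUnion ℝ A A₀ A₁)
    (modular : ∀ {H K} → H ∈ᴬ A₁ → K ∈ᴬ A₁ → ¬ _≈ₕ_ ℝ H K →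
      ∃[ L ] L ∈ᴬ A₀ × ⟦_⟧ ℝ H ∩ ⟦_⟧ ℝ K ⊆ ⟦_⟧ ℝ L) where

    private
      split : ∀ {H} → H ∈ᴬ A → H ∈ᴬ A₀ ⊎ H ∈ᴬ A₁
      split {H} = Equivalence.to (IsDisjointUnion.union A=A₀⊎A₁ {H})

      A₀⊆A : ∀ {H} → H ∈ᴬ A₀ → H ∈ᴬ A
      A₀⊆A {H} p = Equivalence.from (IsDisjointUnion.union A=A₀⊎A₁ {H}) (inj₁ p)

      A₁⊆A : ∀ {H} → H ∈ᴬ A₁ → H ∈ᴬ A
      A₁⊆A {H} p = Equivalence.from (IsDisjointUnion.union A=A₀⊎A₁ {H}) (inj₂ p)

    -- Used at the passages between fibres: `p` and `q` agree on all of `A₁`, so only the hyperplane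
    -- that separates `x` from `y` is left to separate them.
    adjacent-over : ∀ {x y p q} → Adj A₀ x y →
      (∀ H → H ∈ᴬ A₀ → side H p ≈ side H x) → (∀ H → H ∈ᴬ A₀ → side H q ≈ side H y) →
      (∀ H → H ∈ᴬ A₁ → side H p ∼ side H q) → Adj A p q
    adjacent-over {x} {y} {p} {q} (H , H∈A₀ , x≁y , unique) p-over-x q-over-y p∼q =
      H , A₀⊆A {H} H∈A₀ , <-respˡ (sym (*-cong (p-over-x H H∈A₀) (q-over-y H H∈A₀))) x≁y , only
      where
      only : ∀ K → K ∈ᴬ A → side K p ≁ side K q → _≈ₕ_ ℝ H K
      only K K∈A p≁q = [ (λ K∈A₀ → unique K K∈A₀ (<-respˡ (*-cong (p-over-x K K∈A₀) (q-over-y K K∈A₀)) p≁q))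
                       , (λ K∈A₁ → contradiction p≁q (∼⇒¬≁ (p∼q K K∈A₁))) ]′ (split {K} K∈A)

    -- The direction is a parameter because a fibre traversed downwards is obtained as the upward
    -- fibre of the opposite vector.
    module Direction (w : Point ℝ d)
      (w∥A₀ : ∀ H → H ∈ᴬ A₀ → side H w ≈ 0#) (w∦A₁ : ∀ H → H ∈ᴬ A₁ → side H w ≉ 0#) where

      -- The root in `s` of `side H x + s * side H w`. It is linear in `x`, so differences of
      -- crossings are linear forms again.
      crossing : Hyperplane ℝ d → Point ℝ d → Carrier
      crossing H x = - (side H x * inv (side H w))

      shift : Point ℝ d → Carrier → Point ℝ d
      shift x s = x ⊕ s ⊙ w

      abstract
        side-shift₀ : ∀ {H} → H ∈ᴬ A₀ → ∀ x s → side H (shift x s) ≈ side H x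
        side-shift₀ {H} H∈A₀ x s = trans (dot-along (normal H) x s w)
          (trans (+-congˡ (*-congˡ (w∥A₀ H H∈A₀))) (solve 2 (λ x s → x :+ s :* :0 := x) refl (side H x) s))

        side-shift₁ : ∀ {H} → H ∈ᴬ A₁ → ∀ x s → side H (shift x s) ≈ side H w * (s - crossing H x)
        side-shift₁ {H} H∈A₁ x s = begin
          side H (shift x s)                                   ≈⟨ dot-along (normal H) x s w ⟩
          side H x + s * side H w
            ≈⟨ solve 3 (λ x s w → x :+ s :* w := w :* s :+ x :* :1) refl (side H x) s (side H w) ⟩
          side H w * s + side H x * 1#                         ≈⟨ +-congˡ (*-congˡ (*-inv (w∦A₁ H H∈A₁))) ⟨
          side H w * s + side H x * (side H w * inv (side H w))
            ≈⟨ solve 4 (λ x s w i → w :* s :+ x :* (w :* i) := w :* (s :- :- (x :* i))) refl (side H x) s (side H w) (inv (side H w)) ⟩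
          side H w * (s - crossing H x)                        ∎
          where open import Relation.Binary.Reasoning.Setoid setoid

        on-crossing : ∀ {H x s} → H ∈ᴬ A₁ → s ≈ crossing H x → side H (shift x s) ≈ 0#
        on-crossing {H} {x} {s} H∈A₁ e = trans (side-shift₁ {H} H∈A₁ x s)
          (trans (*-congˡ (trans (+-congʳ e) (-‿inverseʳ _))) (zeroʳ _))

        on-crossing⁻¹ : ∀ {H x s} → H ∈ᴬ A₁ → side H (shift x s) ≈ 0# → s ≈ crossing H x
        on-crossing⁻¹ {H} {x} {s} H∈A₁ e = begin
          s                                  ≈⟨ solve 2 (λ s c → s := (s :- c) :+ c) refl s (crossing H x) ⟩
          (s - crossing H x) + crossing H x
            ≈⟨ +-congʳ (*-cancelˡ-0 (w∦A₁ H H∈A₁) (trans (sym (side-shift₁ {H} H∈A₁ x s)) e)) ⟩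
          0# + crossing H x                  ≈⟨ +-identityˡ _ ⟩
          crossing H x                       ∎
          where open import Relation.Binary.Reasoning.Setoid setoid

        crossing-cong : ∀ {H K x} → H ∈ᴬ A₁ → K ∈ᴬ A₁ → _≈ₕ_ ℝ H K → crossing H x ≈ crossing K x
        crossing-cong {H} {K} {x} H∈A₁ K∈A₁ H≈K =
          on-crossing⁻¹ {K} K∈A₁ (proj₁ H≈K {shift x (crossing H x)} (on-crossing {H} H∈A₁ refl))

        after : ∀ {H x s t} → H ∈ᴬ A₁ → t ≈ crossing H x → t < s → side H (shift x s) ∼ side H w
        after {H} {x} {s} H∈A₁ e t<s = ∼-sym (<-respʳ
          (trans (solve 2 (λ w u → w :* w :* u := w :* (w :* u)) refl (side H w) (s - crossing H x)) (*-congˡ (sym (side-shift₁ {H} H∈A₁ x s))))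
          (*-pos (square-pos (w∦A₁ H H∈A₁)) (<⇒difference-pos refl (<-respˡ e t<s))))

        before : ∀ {H x s t} → H ∈ᴬ A₁ → t ≈ crossing H x → s < t → side H (shift x s) ≁ side H w
        before {H} {x} {s} H∈A₁ e s<t = ≁-sym (∼-⇒≁ (<-respʳ
          (trans (solve 3 (λ w s c → w :* w :* (c :- s) := w :* (:- (w :* (s :- c)))) refl (side H w) s (crossing H x))
            (*-congˡ (-‿cong (sym (side-shift₁ {H} H∈A₁ x s)))))
          (*-pos (square-pos (w∦A₁ H H∈A₁)) (<⇒difference-pos refl (<-respʳ e s<t)))))

        -- By modularity, the hyperplane of all x whose line in direction w meets H and K
        -- at the same time belongs to A₀.
        crossing-difference : ∀ {H K} → H ∈ᴬ A₁ → K ∈ᴬ A₁ →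
          _≈ₕ_ ℝ H K ⊎ ∃[ G ] G ∈ᴬ A₀ × ∀ x → side G x ≈ crossing H x - crossing K x
        crossing-difference {H} {K} H∈A₁ K∈A₁ = classify (≋𝟎⊎≉0 g)
          where
          g : Point ℝ d
          g = (- inv (side H w)) ⊙ normal H ⊕ inv (side K w) ⊙ normal K

          difference : ∀ x → dot ℝ g x ≈ crossing H x - crossing K x
          difference x = trans (dot-combine (- inv (side H w)) (normal H) (inv (side K w)) (normal K) x)
            (solve 4 (λ i h j k → (:- i) :* h :+ j :* k := :- (h :* i) :- (:- (k :* j))) refl
              (inv (side H w)) (side H x) (inv (side K w)) (side K x))

          equal-crossings : ∀ x → dot ℝ g x ≈ 0# → crossing H x ≈ crossing K x
          equal-crossings x e = trans (solve 2 (λ a b → a := (a :- b) :+ b) refl (crossing H x) (crossing K x))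
            (trans (+-congʳ (trans (sym (difference x)) e)) (+-identityˡ _))

          classify : g ≋ 𝟎 ⊎ dot ℝ g g ≉ 0# → _≈ₕ_ ℝ H K ⊎ ∃[ G ] G ∈ᴬ A₀ × ∀ x → side G x ≈ crossing H x - crossing K x
          -- A point of `H` has its crossing with `H`, and hence the one with `K`, at parameter
          -- zero, so it lies on `K`.
          classify (inj₁ g≋𝟎) = inj₁ (⊆⇒≈ₕ H K λ {x} Hx≈0 →
            trans (sym (at-0 K x)) (on-crossing {K} K∈A₁ (trans (on-crossing⁻¹ {H} H∈A₁ (trans (at-0 H x) Hx≈0)) (equal-crossings x (dot-𝟎ˡ x g≋𝟎)))))
            where
            at-0 : ∀ L x → side L (shift x 0#) ≈ side L x
            at-0 L x = trans (dot-along (normal L) x 0# w) (solve 2 (λ x w → x :+ :0 :* w := x) refl (side L x) (side L w))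
          classify (inj₂ gg≉0) = inj₂ (G , G∈A₀ , difference)
            where
            G : Hyperplane ℝ d
            G = record { normal = g ; normal≉0 = λ g≋𝟎 → gg≉0 (dot-𝟎ˡ g g≋𝟎) }

            H≉K : ¬ _≈ₕ_ ℝ H K
            H≉K H≈K = gg≉0 (trans (difference g) (trans (+-congʳ (crossing-cong {H} {K} H∈A₁ K∈A₁ H≈K)) (-‿inverseʳ _)))

            -- A point of `G` moved along `w` to its common crossing reaches `H` and `K`, hence the
            -- hyperplane `L` given by modularity. Being parallel to `w`, `L` contains the original
            -- point too, so `G` is `L`.
            G∈A₀ : G ∈ᴬ A₀
            G∈A₀ = let L , L∈A₀ , H∩K⊆L = modular {H} {K} H∈A₁ K∈A₁ H≉K
                       G⊆L = λ {x} Gx≈0 → trans (sym (side-shift₀ {L} L∈A₀ x (crossing H x)))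
                         (H∩K⊆L {shift x (crossing H x)}
                           (on-crossing {H} H∈A₁ refl , on-crossing {K} K∈A₁ (equal-crossings x Gx≈0)))
                       L⊆G = ⊆⇒≈ₕ G L (λ {x} → G⊆L {x})
                   in ∈ᴬ-resp {d} {L} {G} A₀ (proj₂ L⊆G , proj₁ L⊆G) L∈A₀

        -- Otherwise `x` would be a zero of the difference form and thus lie on a hyperplane of
        -- `A₀`.
        crossing-injective : ∀ {H K x} → Off A₀ x → H ∈ᴬ A₁ → K ∈ᴬ A₁ → crossing H x ≈ crossing K x → _≈ₕ_ ℝ H K
        crossing-injective {H} {K} {x} x∈A₀ H∈A₁ K∈A₁ e = [ (λ H≈K → H≈K) , (λ p → contradiction e (apart p)) ]′
          (crossing-difference {H} {K} H∈A₁ K∈A₁)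
          where
          apart : ∃[ G ] G ∈ᴬ A₀ × (∀ x → side G x ≈ crossing H x - crossing K x) → crossing H x ≉ crossing K x
          apart (G , G∈A₀ , difference) e = x∈A₀ G G∈A₀ (trans (difference x) (trans (+-congʳ e) (-‿inverseʳ _)))

        -- The difference of the crossings is the form of a hyperplane of `A₀`, and `x` and `y` are
        -- on the same side of it.
        crossing-order : ∀ {H K x y} → Cell A₀ x y → H ∈ᴬ A₁ → K ∈ᴬ A₁ →
          crossing H y < crossing K y → crossing H x < crossing K x
        crossing-order {H} {K} {x} {y} x∼y H∈A₁ K∈A₁ lt = transfer (crossing-difference {K} {H} K∈A₁ H∈A₁)
          where
          transfer : _≈ₕ_ ℝ K H ⊎ ∃[ G ] G ∈ᴬ A₀ × (∀ x → side G x ≈ crossing K x - crossing H x) → crossing H x < crossing K x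
          transfer (inj₁ K≈H) = contradiction (<-respʳ (crossing-cong {K} {H} K∈A₁ H∈A₁ K≈H) lt) <-irrefl
          transfer (inj₂ (G , G∈A₀ , difference)) = difference-pos⇒< (difference x)
            (∼-pos (<⇒difference-pos (difference y) lt) (∼-sym (x∼y G G∈A₀)))

      crossings : Point ℝ d → List Carrier
      crossings x = sort (map (λ H → crossing H x) (members A₁))

      fibre : Point ℝ d → List (Point ℝ d)
      fibre x = map (shift x) (gaps (crossings x))

      module _ {x : Point ℝ d} (x∈A₀ : Off A₀ x) where

        CrossingOf : Carrier → Set
        CrossingOf t = ∃[ H ] H ∈ᴬ A₁ × t ≈ crossing H x

        ascending : Ascending (crossings x)
        ascending = sort-ascending (map (λ H → crossing H x) (members A₁))

        abstract
          crossings-sound : All CrossingOf (crossings x)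
          crossings-sound = All-sort (All.map⁺ (All.map (λ {H} H∈A₁ → H , H∈A₁ , refl) (members-are-members A₁)))

          -- A member `H` equals a listed hyperplane only as a set of points, and its crossing
          -- equals a listed value only up to `≈`; `P` has to be carried across both.
          crossings-complete : ∀ {P : Pred Carrier 0ℓ} → (∀ {t u} → t ≈ u → P u → P t) →
            All P (crossings x) → ∀ H → H ∈ᴬ A₁ → P (crossing H x)
          crossings-complete {P} resp ps H H∈A₁ =
            found {Any.lookup H∈A₁} (All.lookupAny (All.zip (members-are-members A₁ , All.map⁻ (All-unsort resp (map (λ H → crossing H x) (members A₁)) ps))) H∈A₁)
            where
            found : ∀ {K} → (K ∈ᴬ A₁ × P (crossing K x)) × _≈ₕ_ ℝ H K → P (crossing H x)
            found {K} ((K∈A₁ , p) , H≈K) = resp (crossing-cong {H} {K} H∈A₁ K∈A₁ H≈K) p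

          unique-crossings : AllPairs _≉_ (map (λ H → crossing H x) (members A₁))
          unique-crossings = AllPairs.map⁺ (distinct (members-are-members A₁) (unique A₁))
            where
            distinct : ∀ {Hs} → All (_∈ᴬ A₁) Hs → AllPairs (λ H K → ¬ _≈ₕ_ ℝ H K) Hs →
              AllPairs (λ H K → crossing H x ≉ crossing K x) Hs
            distinct []               []              = []
            distinct (_∷_ {H} H∈ Hs∈) (H≉Hs ∷ uniq) =
              All.zipWith (λ {K} (K∈ , H≉K) e → H≉K (crossing-injective {H} {K} x∈A₀ H∈ K∈ e)) (Hs∈ , H≉Hs)
              ∷ distinct Hs∈ uniq

        length-fibre : length (fibre x) ≡ suc (length (members A₁))
        length-fibre = ≡.trans (length-map _ (gaps (crossings x))) (≡.trans (length-gaps (crossings x))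
          (≡.cong suc (≡.trans (length-sort unique-crossings) (length-map _ (members A₁)))))

        abstract
          fibre-over : All (λ p → ∀ H → H ∈ᴬ A₀ → side H p ≈ side H x) (fibre x)
          fibre-over = All.map⁺ (All.universal (λ s H H∈A₀ → side-shift₀ {H} H∈A₀ x s) (gaps (crossings x)))

          fibre-complement : All (Off A) (fibre x)
          fibre-complement = All.map⁺ (All.map off (gaps-avoid ascending))
            where
            off : ∀ {s} → All (Avoids s) (crossings x) → Off A (shift x s)
            off {s} avoids H H∈A = [ (λ H∈A₀ e → x∈A₀ H H∈A₀ (trans (sym (side-shift₀ {H} H∈A₀ x s)) e)) , off₁ ]′ (split {H} H∈A)
              where
              off₁ : H ∈ᴬ A₁ → side H (shift x s) ≉ 0#
              off₁ H∈A₁ = [ (λ t<s → ∼⇒≉0ˡ (after {H} H∈A₁ refl t<s))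
                          , (λ s<t e → ∼⇒≉0ˡ (≁⇒∼- (before {H} H∈A₁ refl s<t)) e) ]′
                (crossings-complete {Avoids s} (λ t≈u → Sum.map (<-respˡ (sym t≈u)) (<-respʳ (sym t≈u))) avoids H H∈A₁)

          crosses⇒adjacent : ∀ {s s′} → Crosses s s′ (crossings x) → Adj A (shift x s) (shift x s′)
          crosses⇒adjacent {s} {s′} c = adjacent (crosses-one ascending crossings-sound c)
            where
            adjacent : ∃[ t ] CrossingOf t × s < t × t < s′ × All (λ u → SameSide s s′ u ⊎ u ≈ t) (crossings x) →
              Adj A (shift x s) (shift x s′)
            adjacent (t , (H , H∈A₁ , t≈) , s<t , t<s′ , others) =
              H , A₁⊆A {H} H∈A₁ , ≁-∼-trans (before {H} H∈A₁ t≈ s<t) (∼-sym (after {H} H∈A₁ t≈ t<s′)) , only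
              where
              only : ∀ K → K ∈ᴬ A → side K (shift x s) ≁ side K (shift x s′) → _≈ₕ_ ℝ H K
              only K K∈A opposite = [ only₀ , only₁ ]′ (split {K} K∈A)
                where
                only₀ : K ∈ᴬ A₀ → _≈ₕ_ ℝ H K
                only₀ K∈A₀ = contradiction opposite (∼⇒¬≁ (∼-respˡ (sym (side-shift₀ {K} K∈A₀ x s))
                  (∼-respʳ (sym (side-shift₀ {K} K∈A₀ x s′)) (∼-refl (x∈A₀ K K∈A₀)))))

                only₁ : K ∈ᴬ A₁ → _≈ₕ_ ℝ H K
                only₁ K∈A₁ = decide (crossings-complete {λ u → SameSide s s′ u ⊎ u ≈ t} resp others K K∈A₁)
                  where
                  resp : ∀ {u v} → u ≈ v → SameSide s s′ v ⊎ v ≈ t → SameSide s s′ u ⊎ u ≈ t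
                  resp u≈v (inj₁ (inj₁ (p , q))) = inj₁ (inj₁ (<-respˡ (sym u≈v) p , <-respˡ (sym u≈v) q))
                  resp u≈v (inj₁ (inj₂ (p , q))) = inj₁ (inj₂ (<-respʳ (sym u≈v) p , <-respʳ (sym u≈v) q))
                  resp u≈v (inj₂ v≈t)            = inj₂ (trans u≈v v≈t)

                  decide : SameSide s s′ (crossing K x) ⊎ crossing K x ≈ t → _≈ₕ_ ℝ H K
                  decide (inj₁ (inj₁ (p , q))) = contradiction opposite (∼⇒¬≁ (∼-trans (after {K} K∈A₁ refl p) (∼-sym (after {K} K∈A₁ refl q))))
                  decide (inj₁ (inj₂ (p , q))) = contradiction opposite (∼⇒¬≁ (≁-trans (before {K} K∈A₁ refl p) (≁-sym (before {K} K∈A₁ refl q))))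
                  decide (inj₂ e)              = crossing-injective {H} {K} x∈A₀ H∈A₁ K∈A₁ (sym (trans e t≈))

          path-shift : ∀ {a b ss} → Path (λ s s′ → Crosses s s′ (crossings x)) a ss b →
            Path (Adj A) (shift x a) (map (shift x) ss) (shift x b)
          path-shift [ s ]   = [ _ ]
          path-shift (c ∷ p) = crosses⇒adjacent c ∷ path-shift p

          fibre-path : ∃[ p ] ∃[ q ] Path (Adj A) p (fibre x) q ×
            ((∀ H → H ∈ᴬ A₀ → side H p ≈ side H x) × (∀ H → H ∈ᴬ A₁ → side H p ≁ side H w)) ×
            ((∀ H → H ∈ᴬ A₀ → side H q ≈ side H x) × (∀ H → H ∈ᴬ A₁ → side H q ∼ side H w))
          fibre-path = let a , b , p , a<ts , ts<b = gaps-traversal ascending in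
            shift x a , shift x b , path-shift p
            , ((λ H H∈A₀ → side-shift₀ {H} H∈A₀ x a)
              , λ H H∈A₁ → before {H} H∈A₁ refl (crossings-complete {a <_} (λ e → <-respʳ (sym e)) a<ts H H∈A₁))
            , ((λ H H∈A₀ → side-shift₀ {H} H∈A₀ x b)
              , λ H H∈A₁ → after {H} H∈A₁ refl (crossings-complete {_< b} (λ e → <-respˡ (sym e)) ts<b H H∈A₁))

          fibre-distinct : AllPairs (λ p q → ¬ Cell A p q) (fibre x)
          fibre-distinct = AllPairs.map⁺ (AllPairs.map apart (gaps-separated ascending))
            where
            apart : ∀ {s s′} → Any (Between s s′) (crossings x) → ¬ Cell A (shift x s) (shift x s′)
            apart {s} {s′} between cell = refute (All.lookupAny crossings-sound between)
              where
              refute : ∀ {t} → ¬ (CrossingOf t × Between s s′ t)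
              refute ((H , H∈A₁ , t≈) , s<t , t<s′) = ∼⇒¬≁ (cell H (A₁⊆A {H} H∈A₁))
                (≁-∼-trans (before {H} H∈A₁ t≈ s<t) (∼-sym (after {H} H∈A₁ t≈ t<s′)))

          -- On its own line `y` has parameter zero, so the signs of its crossings tell which ones
          -- it has passed. The order of crossings is the same over `x`, which turns this into a cut
          -- of `crossings x`; the sample in that cut lies in the region of `y`.
          fibre-complete : ∀ {y} → Off A y → Cell A₀ x y → Any (λ p → Cell A p y) (fibre x)
          fibre-complete {y} y∈A x∼y = Any.map⁺ (Any.map inCell (gaps-locate L<U ascending (All.map classify crossings-sound)))
            where
            Lower Upper : Pred Carrier 0ℓ
            Lower t = ∃[ H ] H ∈ᴬ A₁ × t ≈ crossing H x × side H y ∼ side H w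
            Upper t = ∃[ H ] H ∈ᴬ A₁ × t ≈ crossing H x × side H y ≁ side H w

            classify : ∀ {t} → CrossingOf t → Lower t ⊎ Upper t
            classify (H , H∈A₁ , t≈) = Sum.map (λ s → H , H∈A₁ , t≈ , s) (λ s → H , H∈A₁ , t≈ , s)
              (∼⊎≁ (y∈A H (A₁⊆A {H} H∈A₁)) (w∦A₁ H H∈A₁))

            side≈ : ∀ {H} → H ∈ᴬ A₁ → side H y ≈ side H w * (- crossing H y)
            side≈ {H} H∈A₁ = begin
              side H y                                      ≈⟨ *-identityʳ _ ⟨
              side H y * 1#                                 ≈⟨ *-congˡ (*-inv (w∦A₁ H H∈A₁)) ⟨
              side H y * (side H w * inv (side H w))
                ≈⟨ solve 3 (λ y w i → y :* (w :* i) := w :* (:- (:- (y :* i)))) refl (side H y) (side H w) (inv (side H w)) ⟩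
              side H w * (- crossing H y)                   ∎
              where open import Relation.Binary.Reasoning.Setoid setoid

            -- On the line through `y` the crossing of `H` is negative and that of `K` positive;
            -- `crossing-order` carries the inequality over to `x`.
            L<U : ∀ {t u} → Lower t → Upper u → t < u
            L<U (H , H∈A₁ , t≈ , y∼w) (K , K∈A₁ , u≈ , y≁w) =
              <-respˡ (sym t≈) (<-respʳ (sym u≈) (crossing-order {H} {K} x∼y H∈A₁ K∈A₁ (Order.trans negative positive)))
              where
              negative : crossing H y < 0#
              negative = <-respˡ (solve 1 (λ c → :- (:- c) := c) refl (crossing H y)) (pos⇒-neg
                (*-pos-cancelˡ (square-pos (w∦A₁ H H∈A₁)) (<-respʳ
                  (trans (*-congʳ (side≈ {H} H∈A₁)) (solve 2 (λ w c → w :* c :* w := w :* w :* c) refl (side H w) (- crossing H y))) y∼w)))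
              positive : 0# < crossing K y
              positive = *-pos-cancelˡ (square-pos (w∦A₁ K K∈A₁)) (<-respʳ
                (trans (*-congʳ (-‿cong (side≈ {K} K∈A₁))) (solve 2 (λ w c → (:- (w :* (:- c))) :* w := w :* w :* c) refl (side K w) (crossing K y)))
                (≁⇒-∼ y≁w))

            inCell : ∀ {s} → All (Splits Lower Upper s) (crossings x) → Cell A (shift x s) y
            inCell {s} splits H H∈A = [ (λ H∈A₀ → ∼-respˡ (sym (side-shift₀ {H} H∈A₀ x s)) (x∼y H H∈A₀)) , inCell₁ ]′ (split {H} H∈A)
              where
              resp : ∀ {t u} → t ≈ u → Splits Lower Upper s u → Splits Lower Upper s t
              resp t≈u (inj₁ ((H , H∈A₁ , u≈ , y∼) , p)) = inj₁ ((H , H∈A₁ , trans t≈u u≈ , y∼) , <-respˡ (sym t≈u) p)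
              resp t≈u (inj₂ ((H , H∈A₁ , u≈ , y≁) , p)) = inj₂ ((H , H∈A₁ , trans t≈u u≈ , y≁) , <-respʳ (sym t≈u) p)

              inCell₁ : H ∈ᴬ A₁ → side H (shift x s) ∼ side H y
              inCell₁ H∈A₁ = compare (crossings-complete {Splits Lower Upper s} resp splits H H∈A₁)
                where
                -- The class of a crossing value may be witnessed by another hyperplane `K` with the
                -- same crossing; off `A₀` this forces `K` to equal `H`.
                same : ∀ {K} → K ∈ᴬ A₁ → crossing H x ≈ crossing K x → side K (shift x s) ∼ side K y → side H (shift x s) ∼ side H y
                same {K} K∈A₁ e = ≈ₕ-∼ K H (crossing-injective {K} {H} x∈A₀ K∈A₁ H∈A₁ (sym e))

                compare : Splits Lower Upper s (crossing H x) → side H (shift x s) ∼ side H y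
                compare (inj₁ ((K , K∈A₁ , e , y∼w) , t<s)) = same {K} K∈A₁ e (∼-trans (after {K} K∈A₁ e t<s) (∼-sym y∼w))
                compare (inj₂ ((K , K∈A₁ , e , y≁w) , s<t)) = same {K} K∈A₁ e (≁-trans (before {K} K∈A₁ e s<t) (≁-sym y≁w))

    -- The direction of travel after n fibres.
    turn : ℕ → Bool → Bool
    turn zero    b = b
    turn (suc n) b = turn n (not b)

    turn-even : ∀ q b → turn (q ℕ.* 2) b ≡ b
    turn-even zero    b     = ≡.refl
    turn-even (suc q) true  = turn-even q true
    turn-even (suc q) false = turn-even q false

    -- Lifting a tour by alternating directions

    module _ (v : Point ℝ d)
      (v∥A₀ : ∀ H → H ∈ᴬ A₀ → side H v ≈ 0#) (v∦A₁ : ∀ H → H ∈ᴬ A₁ → side H v ≉ 0#) where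

      direction : Bool → Point ℝ d
      direction true  = v
      direction false = (- 1#) ⊙ v

      abstract
        side-reversed : ∀ H → side H ((- 1#) ⊙ v) ≈ - side H v
        side-reversed H = trans (dot-⊙ʳ (- 1#) (normal H) v) (solve 1 (λ a → (:- :1) :* a := :- a) refl (side H v))

        direction∥A₀ : ∀ b H → H ∈ᴬ A₀ → side H (direction b) ≈ 0#
        direction∥A₀ true  H H∈A₀ = v∥A₀ H H∈A₀
        direction∥A₀ false H H∈A₀ = trans (dot-⊙ʳ (- 1#) (normal H) v) (trans (*-congˡ (v∥A₀ H H∈A₀)) (zeroʳ _))

        direction-flip : ∀ b H → H ∈ᴬ A₁ → side H (direction b) ≁ side H (direction (not b))
        direction-flip true  H H∈A₁ = ≁-sym (direction-flip false H H∈A₁)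
        direction-flip false H H∈A₁ = ≁-sym (∼-⇒≁ (∼-respʳ
          (trans (solve 1 (λ a → a := :- (:- a)) refl (side H v)) (-‿cong (sym (side-reversed H))))
          (∼-refl (v∦A₁ H H∈A₁))))

        direction∦A₁ : ∀ b H → H ∈ᴬ A₁ → side H (direction b) ≉ 0#
        direction∦A₁ b H H∈A₁ = ∼⇒≉0ˡ (≁⇒∼- (direction-flip b H H∈A₁))

      module Oriented (b : Bool) = Direction (direction b) (direction∥A₀ b) (direction∦A₁ b)

      lift : Bool → List (Point ℝ d) → List (Point ℝ d)
      lift b []       = []
      lift b (x ∷ xs) = Oriented.fibre b x ++ lift (not b) xs

      -- p lies over x, at the start of the fibre as traversed in direction b.
      Ready : Point ℝ d → Point ℝ d → Bool → Set
      Ready p x b = (∀ H → H ∈ᴬ A₀ → side H p ≈ side H x) × (∀ H → H ∈ᴬ A₁ → side H p ≁ side H (direction b))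

      link : ∀ b {p q x y} → Ready p x b → Ready q y b → Adj A₀ x y → Adj A p q
      link b (p-over-x , p≁) (q-over-y , q≁) x~y =
        adjacent-over x~y p-over-x q-over-y λ H H∈A₁ → ≁-trans (p≁ H H∈A₁) (≁-sym (q≁ H H∈A₁))

      -- Having passed all of `A₁` in one direction means having all of it ahead in the opposite
      -- one, so the end is ready for `not b`.
      oriented-path : ∀ b {x} → Off A₀ x → ∃[ p ] ∃[ q ] Path (Adj A) p (Oriented.fibre b x) q × Ready p x b × Ready q x (not b)
      oriented-path b x∈A₀ = let p , q , path , p-ready , (q-over-x , q∼) = Oriented.fibre-path b x∈A₀ in
        p , q , path , p-ready , q-over-x , λ H H∈A₁ → ∼-≁-trans (q∼ H H∈A₁) (direction-flip b H H∈A₁)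

      lift-path : ∀ b {x xs y} → Path (Adj A₀) x xs y → All (Off A₀) xs →
        ∃[ p ] ∃[ q ] Path (Adj A) p (lift b xs) q × Ready p x b × Ready q y (turn (length xs) b)
      lift-path b [ x ] (x∈A₀ ∷ []) = let p , q , path , p-ready , q-ready = oriented-path b x∈A₀ in
        p , q , ≡.subst (λ ps → Path (Adj A) p ps q) (≡.sym (++-identityʳ _)) path , p-ready , q-ready
      lift-path b (r ∷ path) (x∈A₀ ∷ xs∈A₀) =
        let p , q , fibre-path , p-ready , q-ready = oriented-path b x∈A₀
            p′ , q′ , rest , p′-ready , q′-ready = lift-path (not b) path xs∈A₀
        in p , q′ , fibre-path ▸ link (not b) q-ready p′-ready r ∷ rest , p-ready , q′-ready

      lift-All : ∀ {P Q : Point ℝ d → Set} → (∀ b {x} → Q x → All P (Oriented.fibre b x)) →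
        ∀ b {xs} → All Q xs → All P (lift b xs)
      lift-All f b []       = []
      lift-All f b (q ∷ qs) = All.++⁺ (f b q) (lift-All f (not b) qs)

      -- Points of different fibres are told apart by `A₀` alone, since each has the same values on
      -- `A₀` as its base point.
      lift-distinct : ∀ b {xs} → All (Off A₀) xs → AllPairs (λ x y → ¬ Cell A₀ x y) xs →
        AllPairs (λ p q → ¬ Cell A p q) (lift b xs)
      lift-distinct b []               []             = []
      lift-distinct b {x ∷ xs} (x∈A₀ ∷ xs∈A₀) (x≁xs ∷ xs≁xs) = AllPairs.++⁺
        (Oriented.fibre-distinct b x∈A₀) (lift-distinct (not b) xs∈A₀ xs≁xs)
        (All.map (λ {p} p-over-x → lift-All {λ q → ¬ Cell A p q} {λ y → Off A₀ y × ¬ Cell A₀ x y}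
          (λ b′ {y} (y∈A₀ , x≁y) → All.map (λ {q} q-over-y p∼q → x≁y λ H H∈A₀ →
            ∼-respˡ (p-over-x H H∈A₀) (∼-respʳ (q-over-y H H∈A₀) (p∼q H (A₀⊆A {H} H∈A₀))))
            (Oriented.fibre-over b′ y∈A₀))
          (not b) (All.zip (xs∈A₀ , x≁xs))) (Oriented.fibre-over b x∈A₀))

      lift-complete : ∀ b {xs y} → All (Off A₀) xs → Off A y → Any (λ x → Cell A₀ x y) xs →
        Any (λ p → Cell A p y) (lift b xs)
      lift-complete b (x∈A₀ ∷ _)  y∈A (here x∼y) = Any.++⁺ˡ (Oriented.fibre-complete b x∈A₀ y∈A x∼y)
      lift-complete b {x ∷ _} (_ ∷ xs∈A₀) y∈A (there i) = Any.++⁺ʳ (Oriented.fibre b x) (lift-complete (not b) xs∈A₀ y∈A i)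

      length-lift : ∀ b {xs} → All (Off A₀) xs → length (lift b xs) ≡ length xs ℕ.* suc (length (members A₁))
      length-lift b []                   = ≡.refl
      length-lift b {x ∷ _} (x∈A₀ ∷ xs∈A₀) = ≡.trans (length-++ (Oriented.fibre b x))
        (≡.cong₂ ℕ._+_ (Oriented.length-fibre b x∈A₀) (length-lift (not b) xs∈A₀))

      liftTour : (T : Tour A₀) → ∃[ T′ ] length (Tour.visits {A = A} T′) ≡ length (Tour.visits T) ℕ.* suc (length (members A₁))
      liftTour T =
        let p , q , path′ , p-ready , q-ready = lift-path true path complement
        in record
          { path       = path′
          -- After an even number of fibres the direction is `true` again, so the last point stands
          -- on the same side of `A₁` as the first.
          ; closing    = link true (≡.subst (Ready q last) (turned even) q-ready) p-ready closing
          ; complement = lift-All (λ b x∈A₀ → Oriented.fibre-complement b x∈A₀) true complement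
          ; distinct   = lift-distinct true complement distinct
          ; complete   = λ y y∈A → lift-complete true complement y∈A (complete y λ H H∈A₀ → y∈A H (A₀⊆A {H} H∈A₀))
          ; even       = ≡.subst (2 ∣_) (≡.sym (length-lift true complement)) (∣m⇒∣m*n _ even)
          } , length-lift true complement
        where
        open Tour T
        turned : 2 ∣ length visits → turn (length visits) true ≡ true
        turned (divides q e) = ≡.trans (≡.cong (λ n → turn n true) e) (turn-even q true)

-- Supersolvable arrangements

module Supersolvability (ℝ : CompleteOrderedField) where
  open CompleteOrderedField ℝ hiding (zero; _≤_)
  open OrderedField ℝ
  open LinearAlgebra ℝ
  open Cells ℝ
  open Fibres ℝ
  open VectorEquality setoid using (_≋_)
  open Arrangement
  open Hyperplane
  open HasDimension
  open IntegerCoefficients.RingSolver ℝ using (solve; _:=_; _:+_; _:*_; _:-_; :-_)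

  module _ {d : ℕ} where

    NormalsIn : Pred (Point ℝ d) _ → Arrangement ℝ d → Set
    NormalsIn W A = All (λ H → W (normal H)) (members A)

    rank-normals : ∀ A {n} (r : HasRank ℝ A n) → NormalsIn (Span ℝ (basis r)) A
    rank-normals A r = All.tabulate λ {H} H∈A → ≡.subst (λ K → Span ℝ (basis r) (normal K)) (≡.sym (Any.lookup-index H∈A))
      (spanning r (Span-basis (λ i → normal (lookup (members A) i)) (Any.index H∈A)))

    normals⇒Span⊆ : ∀ A {k} {b : Fin k → Point ℝ d} → NormalsIn (Span ℝ b) A →
      Span ℝ (λ i → normal (lookup (members A) i)) ⊆ Span ℝ b
    normals⇒Span⊆ A {b = b} normals = Span-least (Span-subspace b) λ i → All.lookup normals (∈-lookup i)

    rank≤ : ∀ A {k n} {b : Fin k → Point ℝ d} → NormalsIn (Span ℝ b) A → HasRank ℝ A n → n ≤ k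
    rank≤ A {b = b} normals r = independent-in-span {v = basis r} {b} (independent r) λ i → normals⇒Span⊆ A normals (basis⊆W r i)

    Span-annihilated : ∀ {k} {b : Fin k → Point ℝ d} {h : Point ℝ d} v → Span ℝ b h → (∀ i → dot ℝ (b i) v ≈ 0#) → dot ℝ h v ≈ 0#
    Span-annihilated {b = b} {h} v h∈b bv≈0 = Span-least {v = b} {λ h → dot ℝ h v ≈ 0#} (annihilator-subspace v) bv≈0 {h} h∈b

    ∀ᴬ-kernel : ∀ A {x : Point ℝ d} → All (λ H → side H x ≈ 0#) (members A) → ∀ H → H ∈ᴬ A → side H x ≈ 0#
    ∀ᴬ-kernel A {x} kernel H H∈A = vanishes {Any.lookup H∈A} (All.lookupAny kernel H∈A)
      where
      vanishes : ∀ {K} → side K x ≈ 0# × _≈ₕ_ ℝ H K → side H x ≈ 0#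
      vanishes (e , _ , K⊆H) = K⊆H {x} e

    -- If all normals of `A` lay in the span of the `k` vectors `b`, the rank would be at most `k`.
    -- So some normal lies outside, and the Fredholm alternative gives a `v` that annihilates `b`,
    -- and with it the normals of `A₀`.
    transversal : ∀ {k n} A A₀ (b : Fin k → Point ℝ d) → NormalsIn (Span ℝ b) A₀ → HasRank ℝ A n → k ℕ.< n →
      ∃[ v ] (∀ H → H ∈ᴬ A₀ → side H v ≈ 0#) × ∃[ H ] H ∈ᴬ A × side H v ≉ 0#
    transversal A A₀ b normals₀ r k<n = [ (λ normals → contradiction (rank≤ A normals r) (ℕ.<⇒≱ k<n)) , found ]′
      (All.decide (λ H → span⊎separated b (normal H)) (members A))
      where
      found : Any (λ H → ∃[ v ] (∀ i → dot ℝ (b i) v ≈ 0#) × side H v ≉ 0#) (members A) →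
        ∃[ v ] (∀ H → H ∈ᴬ A₀ → side H v ≈ 0#) × ∃[ H ] H ∈ᴬ A × side H v ≉ 0#
      found i = let H∈A , v , bv≈0 , Hv≉0 = All.lookupAny (members-are-members A) i in
        v , ∀ᴬ-kernel A₀ (All.map (λ {K} h∈b → Span-annihilated {b = b} {normal K} v h∈b bv≈0) normals₀) , Any.lookup i , H∈A , Hv≉0

    module _ {A A₀ A₁ : Arrangement ℝ d} (A=A₀⊎A₁ : IsDisjointUnion ℝ A A₀ A₁)
      (modular : ∀ {H K} → H ∈ᴬ A₁ → K ∈ᴬ A₁ → ¬ _≈ₕ_ ℝ H K →
        ∃[ L ] L ∈ᴬ A₀ × ⟦_⟧ ℝ H ∩ ⟦_⟧ ℝ K ⊆ ⟦_⟧ ℝ L)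
      {v} (v∥A₀ : ∀ H → H ∈ᴬ A₀ → side H v ≈ 0#) where

      -- If K ∈ A₁ contained v, then H ∩ K ⊆ L ∈ A₀ and v ∈ L ∖ H would force K = L ∈ A₀.
      transversal-to-A₁ : ∀ {H} → H ∈ᴬ A₁ → side H v ≉ 0# → ∀ K → K ∈ᴬ A₁ → side K v ≉ 0#
      transversal-to-A₁ {H} H∈A₁ Hv≉0 K K∈A₁ Kv≈0 =
        let L , L∈A₀ , H∩K⊆L = modular {H} {K} H∈A₁ K∈A₁ (λ H≈K → Hv≉0 (proj₂ H≈K {v} Kv≈0))
            K⊆L = λ {x} Kx≈0 → trans (sym (slide-along L x (v∥A₀ L L∈A₀)))
              (H∩K⊆L {slide (normal H) v x} (dot-slide-self (normal H) x Hv≉0 , trans (slide-along K x Kv≈0) Kx≈0))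
            K≈L = ⊆⇒≈ₕ K L (λ {x} → K⊆L {x})
        in IsDisjointUnion.disjoint A=A₀⊎A₁ {K} (∈ᴬ-resp {d} {L} {K} A₀ (proj₂ K≈L , proj₁ K≈L) L∈A₀ , K∈A₁)
        where
        slide-along : ∀ L x → side L v ≈ 0# → side L (slide (normal H) v x) ≈ side L x
        slide-along L x Lv≈0 = trans (dot-slide (normal L) (normal H) v x) (trans (+-congˡ (-‿cong (*-congˡ Lv≈0)))
          (solve 2 (λ a b → a :- b :* :0 := a) refl (side L x) (side H x * inv (side H v))))

      extendTour : ∀ {H} → H ∈ᴬ A → side H v ≉ 0# → Tour A₀ → ∃[ T ] 3 ≤ length (Tour.visits {A = A} T)
      extendTour {H} H∈A Hv≉0 T₀ = [ (λ H∈A₀ → contradiction (v∥A₀ H H∈A₀) Hv≉0) , extend ]′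
        (Equivalence.to (IsDisjointUnion.union A=A₀⊎A₁ {H}) H∈A)
        where
        extend : H ∈ᴬ A₁ → ∃[ T ] 3 ≤ length (Tour.visits {A = A} T)
        extend H∈A₁ =
          let T , e = liftTour A=A₀⊎A₁ (λ {H} {K} → modular {H} {K}) v v∥A₀ (transversal-to-A₁ {H} H∈A₁ Hv≉0) T₀
          -- The length of `T₀` is even and nonzero, hence at least 2, and `A₁` contains `H`, so
          -- each fibre has at least 2 points; the product is at least 4.
          in T , ≡.subst (3 ≤_) (≡.sym e) (ℕ.≤-trans (ℕ.n≤1+n 3)
            (ℕ.*-mono-≤ (even-nonzero (Tour.path T₀) (Tour.even T₀)) (s≤s (nonempty H∈A₁))))
          where
          even-nonzero : ∀ {R : Point ℝ d → Point ℝ d → Set} {x xs y} → Path R x xs y → 2 ∣ length xs → 2 ≤ length xs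
          even-nonzero [ _ ]   = ∣⇒≤
          even-nonzero (_ ∷ _) = ∣⇒≤
          nonempty : ∀ {P : Pred (Hyperplane ℝ d) _} {Hs} → Any P Hs → 1 ≤ length Hs
          nonempty (here _)  = s≤s z≤n
          nonempty (there _) = s≤s z≤n

    -- Arrangements of rank one and two

    singleton : Hyperplane ℝ d → Arrangement ℝ d
    singleton H = record { members = H ∷ [] ; unique = [] ∷ [] }

    -- The normal and its negative represent the two sides; the one edge between them is walked
    -- forth and back.
    singletonTour : ∀ H → Tour (singleton H)
    singletonTour H = record
      { path       = adjacent u≁-u ∷ [ -u ]
      ; closing    = adjacent (≁-sym u≁-u)
      ; complement = off (∼⇒≉0ˡ (≁⇒∼- u≁-u)) ∷ off (∼⇒≉0ˡ (≁⇒∼- (≁-sym u≁-u))) ∷ []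
      ; distinct   = ((λ u∼-u → ∼⇒¬≁ (u∼-u H H∈) u≁-u) ∷ []) ∷ [] ∷ []
      ; complete   = λ y y∈ → [ (λ u∼y → here (cell u∼y)) , (λ u≁y → there (here (cell (≁-trans (≁-sym u≁-u) u≁y)))) ]′
                       (∼⊎≁ (pos⇒≉0 Hu>0) (y∈ H H∈))
      ; even       = ∣-refl
      }
      where
      H∈ : H ∈ᴬ singleton H
      H∈ = here ((λ {y} p → p) , (λ {y} p → p))

      u -u : Point ℝ d
      u = normal H
      -u = (- 1#) ⊙ normal H

      Hu>0 : 0# < side H u
      Hu>0 = ≉𝟎⇒dot-self-pos (normal≉0 H)

      u≁-u : side H u ≁ side H -u
      u≁-u = ∼-⇒≁ (∼-respʳ (trans (solve 1 (λ a → a := :- ((:- :1) :* a)) refl (side H u)) (-‿cong (sym (dot-⊙ʳ (- 1#) u u))))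
        (∼-refl (pos⇒≉0 Hu>0)))

      only : ∀ {K} → K ∈ᴬ singleton H → _≈ₕ_ ℝ H K
      only (here (K⊆H , H⊆K)) = (λ {x} → H⊆K {x}) , (λ {x} → K⊆H {x})

      off : ∀ {x} → side H x ≉ 0# → Off (singleton H) x
      off {x} Hx≉0 K K∈ Kx≈0 = Hx≉0 (proj₂ (only {K} K∈) {x} Kx≈0)

      cell : ∀ {x y} → side H x ∼ side H y → Cell (singleton H) x y
      cell x∼y K K∈ = ≈ₕ-∼ H K (only {K} K∈) x∼y

      adjacent : ∀ {x y} → side H x ≁ side H y → Adj (singleton H) x y
      adjacent x≁y = H , H∈ , x≁y , λ K K∈ _ → only {K} K∈

    -- Three normals in a plane are dependent, and the relation involves that of L since H ≠ K.
    planar-modular : ∀ {k} {b : Fin k → Point ℝ d} → k ≤ 2 → ∀ {H K L : Hyperplane ℝ d} →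
      Span ℝ b (normal H) → Span ℝ b (normal K) → Span ℝ b (normal L) → ¬ _≈ₕ_ ℝ H K → ⟦_⟧ ℝ H ∩ ⟦_⟧ ℝ K ⊆ ⟦_⟧ ℝ L
    planar-modular {b = b} k≤2 {H} {K} {L} H∈b K∈b L∈b H≉K {x} (Hx≈0 , Kx≈0) = use (dependent-in-span {v = normals} {b} (s≤s k≤2) in-span)
      where
      open import Relation.Binary.Reasoning.Setoid setoid

      normals : Fin 3 → Point ℝ d
      normals zero             = normal H
      normals (suc zero)       = normal K
      normals (suc (suc zero)) = normal L

      in-span : ∀ i → Span ℝ b (normals i)
      in-span zero             = H∈b
      in-span (suc zero)       = K∈b
      in-span (suc (suc zero)) = L∈b

      apply : ∀ (c : Fin 3 → Carrier) y → linearCombination ℝ c normals ≋ 𝟎 →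
        c zero * side H y + (c (suc zero) * side K y + c (suc (suc zero)) * side L y) ≈ 0#
      apply c y e = begin
        a * side H y + (a′ * side K y + a″ * side L y)
          ≈⟨ +-congˡ (dot-combine a′ (normal K) a″ (normal L) y) ⟨
        a * side H y + dot ℝ (a′ ⊙ normal K ⊕ a″ ⊙ normal L) y                ≈⟨ +-congʳ (dot-⊙ˡ a (normal H) y) ⟨
        dot ℝ (a ⊙ normal H) y + dot ℝ (a′ ⊙ normal K ⊕ a″ ⊙ normal L) y      ≈⟨ dot-⊕ˡ (a ⊙ normal H) _ y ⟨
        dot ℝ (a ⊙ normal H ⊕ (a′ ⊙ normal K ⊕ a″ ⊙ normal L)) y
          ≈⟨ dot-𝟎ˡ y (λ j → trans (+-congˡ (+-congˡ (sym (+-identityʳ _)))) (e j)) ⟩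
        0#                                                                    ∎
        where
        a a′ a″ : Carrier
        a  = c zero
        a′ = c (suc zero)
        a″ = c (suc (suc zero))

      use : ∃[ c ] linearCombination ℝ c normals ≋ 𝟎 × ∃[ i ] c i ≉ 0# → side L x ≈ 0#
      use (c , e , nonzero) = by-cases (a″ Order.≟ 0#)
        where
        a a′ a″ : Carrier
        a  = c zero
        a′ = c (suc zero)
        a″ = c (suc (suc zero))

        by-cases : Dec (a″ ≈ 0#) → side L x ≈ 0#
        by-cases (no a″≉0) = *-cancelˡ-0 a″≉0 (begin
          a″ * side L x
            ≈⟨ solve 3 (λ a b c → c := a :* :0 :+ (b :* :0 :+ c)) refl a a′ (a″ * side L x) ⟩
          a * 0# + (a′ * 0# + a″ * side L x)
            ≈⟨ +-cong (*-congˡ (sym Hx≈0)) (+-congʳ (*-congˡ (sym Kx≈0))) ⟩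
          a * side H x + (a′ * side K x + a″ * side L x)     ≈⟨ apply c x e ⟩
          0#                                                 ∎)
        by-cases (yes a″≈0) = ⊥-elim (absurd nonzero)
          where
          relation : ∀ y → a * side H y + a′ * side K y ≈ 0#
          relation y = begin
            a * side H y + a′ * side K y
              ≈⟨ solve 3 (λ a b l → a :+ b := a :+ (b :+ :0 :* l)) refl (a * side H y) (a′ * side K y) (side L y) ⟩
            a * side H y + (a′ * side K y + 0# * side L y)   ≈⟨ +-congˡ (+-congˡ (*-congʳ (sym a″≈0))) ⟩
            a * side H y + (a′ * side K y + a″ * side L y)   ≈⟨ apply c y e ⟩
            0#                                               ∎

          K⊆H : a ≉ 0# → ⟦_⟧ ℝ K ⊆ ⟦_⟧ ℝ H
          K⊆H a≉0 {y} Ky≈0 = *-cancelˡ-0 a≉0 (begin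
            a * side H y                  ≈⟨ solve 2 (λ a b → a := a :+ b :* :0) refl (a * side H y) a′ ⟩
            a * side H y + a′ * 0#        ≈⟨ +-congˡ (*-congˡ (sym Ky≈0)) ⟩
            a * side H y + a′ * side K y  ≈⟨ relation y ⟩
            0#                            ∎)

          H⊆K : a′ ≉ 0# → ⟦_⟧ ℝ H ⊆ ⟦_⟧ ℝ K
          H⊆K a′≉0 {y} Hy≈0 = *-cancelˡ-0 a′≉0 (begin
            a′ * side K y                 ≈⟨ solve 2 (λ a b → b := a :* :0 :+ b) refl a (a′ * side K y) ⟩
            a * 0# + a′ * side K y        ≈⟨ +-congʳ (*-congˡ (sym Hy≈0)) ⟩
            a * side H y + a′ * side K y  ≈⟨ relation y ⟩
            0#                            ∎)

          absurd : ¬ (∃[ i ] c i ≉ 0#)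
          absurd (zero , a≉0)             = H≉K (≈ₕ-sym K H (⊆⇒≈ₕ K H (λ {y} → K⊆H a≉0 {y})))
          absurd (suc zero , a′≉0)        = H≉K (⊆⇒≈ₕ H K (λ {y} → H⊆K a′≉0 {y}))
          absurd (suc (suc zero) , a″≉0)  = a″≉0 a″≈0

    -- The two rank bounds do different work: `2 ≤ n` gives a vector on the first hyperplane `H`
    -- that is off another one, while `k ≤ 2` makes any two others meet inside `H`, which is
    -- modularity over the singleton.
    rank-two-tour : ∀ A {n k} → HasRank ℝ A n → 2 ≤ n → HasRank ℝ A k → k ≤ 2 → ∃[ T ] 3 ≤ length (Tour.visits {A = A} T)
    rank-two-tour A@record { members = [] } r 2≤n _ _ = contradiction (ℕ.≤-trans 2≤n (rank≤ A {zero} {b = λ ()} [] r)) (λ ())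
    rank-two-tour A@record { members = H ∷ Hs ; unique = H≉Hs ∷ uniq } r 2≤n r′ k≤2 =
      let v , v∥A₀ , K , K∈A , Kv≉0 = transversal A A₀ (λ (_ : Fin 1) → normal H) (Span-basis (λ _ → normal H) zero ∷ []) r 2≤n
      in extendTour {A} {A₀} {A₁} decomposition (λ {H} {K} → modular {H} {K}) v∥A₀ {K} K∈A Kv≉0 (singletonTour H)
      where
      A₀ A₁ : Arrangement ℝ d
      A₀ = singleton H
      A₁ = record { members = Hs ; unique = uniq }

      decomposition : IsDisjointUnion ℝ A A₀ A₁
      decomposition = record
        { union    = mk⇔ (λ { (here e) → inj₁ (here e) ; (there i) → inj₂ i })
                         (λ { (inj₁ (here e)) → here e ; (inj₂ i) → there i })
        ; disjoint = λ { (here (K⊆H , H⊆K) , K∈Hs) →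
            let H≉L , K⊆L , L⊆K = All.lookupAny H≉Hs K∈Hs
            in H≉L ((λ {x} p → K⊆L {x} (H⊆K {x} p)) , (λ {x} p → K⊆H {x} (L⊆K {x} p))) }
        }

      planar : ∀ {K} → K ∈ᴬ A₁ → ∃[ K′ ] _≈ₕ_ ℝ K K′ × Span ℝ (basis r′) (normal K′)
      planar K∈A₁ = let K′∈b , K≈K′ = All.lookupAny (All.tail (rank-normals A r′)) K∈A₁ in Any.lookup K∈A₁ , K≈K′ , K′∈b

      modular : ∀ {K L} → K ∈ᴬ A₁ → L ∈ᴬ A₁ → ¬ _≈ₕ_ ℝ K L → ∃[ M ] M ∈ᴬ A₀ × ⟦_⟧ ℝ K ∩ ⟦_⟧ ℝ L ⊆ ⟦_⟧ ℝ M
      modular {K} {L} K∈A₁ L∈A₁ K≉L =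
        let K′ , (K⊆K′ , K′⊆K) , K′∈b = planar {K} K∈A₁
            L′ , (L⊆L′ , L′⊆L) , L′∈b = planar {L} L∈A₁
        in H , here ((λ {x} p → p) , (λ {x} p → p)) , λ {x} (p , q) →
          planar-modular {b = basis r′} k≤2 {K′} {L′} {H} K′∈b L′∈b (All.head (rank-normals A r′))
            (λ (K′⊆L′ , L′⊆K′) → K≉L ((λ {x} p → L′⊆L {x} (K′⊆L′ {x} (K⊆K′ {x} p))) , (λ {x} p → K′⊆K {x} (L′⊆K′ {x} (L⊆L′ {x} p)))))
            {x} (K⊆K′ {x} p , L⊆L′ {x} q)

    supersolvable-tour : ∀ A {n} → HasRank ℝ A n → 2 ≤ n → Supersolvable ℝ A → ∃[ T ] 3 ≤ length (Tour.visits {A = A} T)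
    supersolvable-tour A r 2≤n (rank≤2 r′ k≤2) = rank-two-tour A r 2≤n r′ k≤2
    supersolvable-tour A _ _ (rank≥3 r (s≤s 2≤n) A₀ A₁ A=A₀⊎A₁ _ _ r₀ ss₀ modular) =
      let T₀ , _ = supersolvable-tour A₀ r₀ 2≤n ss₀
          -- The normals of `A₀` lie in the span of `n` vectors, one fewer than the rank of `A`.
          v , v∥A₀ , H , H∈A , Hv≉0 = transversal A A₀ (basis r₀) (rank-normals A₀ r₀) r ℕ.≤-refl
      in extendTour {A} {A₀} {A₁} A=A₀⊎A₁ (λ {H} {K} → modular {H} {K}) v∥A₀ {H} H∈A Hv≉0 T₀

theorem1p1 : (ℝ : CompleteOrderedField) {d n : ℕ} (A : Arrangement ℝ d) →
    HasRank ℝ A n → 2 ≤ n → Supersolvable ℝ A →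
    ∃[ k ] 2 ∣ k × HamiltonianCycle (regionGraph ℝ A) k
theorem1p1 ℝ A r 2≤n ss =
  let T , 3≤length = Supersolvability.supersolvable-tour ℝ A r 2≤n ss
  in _ , Cells.Tour.even T , Cells.hamiltonianCycle ℝ T 3≤length
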